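{- Let $\delta\in(0,1/2)$. Assume that $M,N\colon G\to\mathbb C$ satisfy $\Psi_M\Psi_{N,N}\ne0$ and $\beta(N)\le\frac\delta4\beta(M)$. Then, for $\alpha\in\mathbb C$, the maximum of $\beta(M+\alpha N)$ occurs for $$\alpha=\alpha_1:=\frac{\overline{\Psi_M}\Psi_{M,N}-\overline{\Psi_N}\Psi_{M,M}}{\overline{\Psi_N}\,\overline{\Psi_{M,N}}-\overline{\Psi_M}\Psi_{N,N}}$$ and is $$\beta(M+\alpha_1N)=\frac{|\Psi_N|^2\Psi_{M,M}+|\Psi_M|^2\Psi_{N,N}-2\mathrm{Re}(\overline{\Psi_M}\Psi_N\Psi_{M,N})}{\Psi_{M,M}\Psi_{N,N}-|\Psi_{M,N}|^2}=\beta(M)+\frac{|\overline{\Psi_M}\Psi_{M,N}-\overline{\Psi_N}\Psi_{M,M}|^2}{\Psi_{M,M}(\Psi_{M,M}\Psi_{N,N}-|\Psi_{M,N}|^2)},$$ the denominators in these expressions for $\beta(M+\alpha_1N)$ being positive. Furthermore: (i) If $|\Psi_{M,N}|^2\ge\delta\,\Psi_{M,M}\Psi_{N,N}$, then $\beta(M+\alpha_1N)-\beta(M)\ge\frac\delta4\beta(M)$. (ii) If $|\Psi_{M,N}|^2\le\delta\,\Psi_{M,M}\Psi_{N,N}$, then $\beta(M+\alpha N)-\beta(M)\le5\delta\,\beta(M)$ for every $\alpha\in\mathbb C$.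
   Context: $G$ is an (indexing) set, $L\colon G\to\mathbb C$ is a function, and $w\colon G\to[0,\infty)$ is a weight function, not identically $0$. For $f\colon G\to\mathbb C$ put $\mathbb E^w_{\pi\in G}f(\pi):=\frac{\sum_{\pi\in G}w(\pi)f(\pi)}{\sum_{\pi\in G}w(\pi)}$. For $M,N\colon G\to\mathbb C$ define $\Psi_M:=\mathbb E^w_{\pi\in G}L(\pi)M(\pi)$, $\Psi_{M,N}:=\mathbb E^w_{\pi\in G}L(\pi)M(\pi)\overline{L(\pi)N(\pi)}$, and $\beta(M):=|\Psi_M|^2/\Psi_{M,M}$ if $\Psi_{M,M}\ne0$, $\beta(M):=0$ if $\Psi_{M,M}=0$. It is assumed that the series $\sum_\pi w(\pi)$ and $\sum_\pi w(\pi)|L(\pi)M(\pi)|^2$ converge for every function $M$ considered (automatic if $G$ is finite). -}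

module Defs where

open import Level using (0ℓ) renaming (suc to lsuc)
open import Algebra.Bundles using (CommutativeRing)
open import Axiom.ExcludedMiddle using (ExcludedMiddle)
open import Data.List.Base using (List; map; foldr)
open import Data.List.Relation.Binary.Subset.Propositional using (_⊆_)
open import Data.List.Relation.Unary.Unique.Propositional using (Unique)
open import Data.Product using (∃; _×_; _,_)
open import Relation.Binary.Structures using (IsTotalOrder)
open import Relation.Nullary using (¬_; Dec; yes; no)

-- The axioms that characterise the real numbers up to isomorphism.  The library
-- has no real numbers, so "ℝ" below is an arbitrary model of these axioms.
record CompleteOrderedField : Set (lsuc 0ℓ) where
  infix  8 _⁻¹
  infixl 7 _/_
  infix  4 _≤_ _<_
  field
    commutativeRing : CommutativeRing 0ℓ 0ℓ
  open CommutativeRing commutativeRing public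
  field
    1≉0          : ¬ (1# ≈ 0#)
    -- Total for convenience; its value at 0# is left unspecified.
    _⁻¹          : Carrier → Carrier
    ⁻¹-cong      : ∀ {x y} → x ≈ y → x ⁻¹ ≈ y ⁻¹
    *-inverseʳ   : ∀ {x} → ¬ (x ≈ 0#) → x * x ⁻¹ ≈ 1#
    _≤_          : Carrier → Carrier → Set
    isTotalOrder : IsTotalOrder _≈_ _≤_
    +-monoʳ-≤    : ∀ x {y z} → y ≤ z → x + y ≤ x + z
    *-nonneg     : ∀ {x y} → 0# ≤ x → 0# ≤ y → 0# ≤ x * y

  IsUpperBound : (Carrier → Set) → Carrier → Set
  IsUpperBound P b = ∀ x → P x → x ≤ b

  field
    supremum : ∀ (P : Carrier → Set) → ∃ P → ∃ (IsUpperBound P) →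
               ∃ λ s → IsUpperBound P s × (∀ b → IsUpperBound P b → s ≤ b)

  _<_ : Carrier → Carrier → Set
  x < y = x ≤ y × ¬ (x ≈ y)

  _/_ : Carrier → Carrier → Carrier
  x / y = x * y ⁻¹

  2# 4# 5# : Carrier
  2# = 1# + 1#
  4# = 2# + 2#
  5# = 4# + 1#

-- Excluded middle is the classical ambient logic: it makes the case distinction
-- in β and the value of an infinite sum into functions.
module Analysis (em : ExcludedMiddle 0ℓ) (𝓡 : CompleteOrderedField) where

  open CompleteOrderedField 𝓡 public renaming (Carrier to ℝ)

  infixl 7 _*ᶜ_ _/ᶜ_
  infixl 6 _+ᶜ_ _-ᶜ_
  infix  4 _≈ᶜ_

  record ℂ : Set where
    constructor _+i_
    field
      re im : ℝ
  open ℂ public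

  _≈ᶜ_ : ℂ → ℂ → Set
  z ≈ᶜ z′ = re z ≈ re z′ × im z ≈ im z′

  fromℝ : ℝ → ℂ
  fromℝ x = x +i 0#

  0ᶜ : ℂ
  0ᶜ = fromℝ 0#

  _+ᶜ_ _-ᶜ_ _*ᶜ_ _/ᶜ_ : ℂ → ℂ → ℂ
  (a +i b) +ᶜ (c +i d) = (a + c) +i (b + d)
  (a +i b) -ᶜ (c +i d) = (a - c) +i (b - d)
  (a +i b) *ᶜ (c +i d) = (a * c - b * d) +i (a * d + b * c)

  conj : ℂ → ℂ
  conj (a +i b) = a +i (- b)

  ∣_∣² : ℂ → ℝ
  ∣ a +i b ∣² = a * a + b * b

  z /ᶜ z′ = z *ᶜ (conj z′ *ᶜ fromℝ (∣ z′ ∣² ⁻¹))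

  module _ {G : Set} where

    finSum : (G → ℝ) → List G → ℝ
    finSum f F = foldr _+_ 0# (map f F)

    -- Unordered summation: convergence along the net of finite subsets of G,
    -- represented as duplicate-free lists.
    HasSum : (G → ℝ) → ℝ → Set
    HasSum f s = ∀ ε → 0# < ε → ∃ λ F₀ → Unique F₀ ×
      (∀ F → Unique F → F₀ ⊆ F → s - ε < finSum f F × finSum f F < s + ε)

    Summable : (G → ℝ) → Set
    Summable f = ∃ (HasSum f)

    valueOr0 : ∀ {f} → Dec (Summable f) → ℝ
    valueOr0 (yes (s , _)) = s
    valueOr0 (no _)        = 0#

    -- The value of the series; 0# by convention if f is not summable.
    ∑ : (G → ℝ) → ℝ
    ∑ f = valueOr0 {f} em

    -- A complex series converges iff its real and imaginary parts do.
    ∑ᶜ : (G → ℂ) → ℂ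
    ∑ᶜ f = ∑ (λ π → re (f π)) +i ∑ (λ π → im (f π))

  module Weighted {G : Set} (w : G → ℝ) (L : G → ℂ) where

    𝔼 : (G → ℂ) → ℂ
    𝔼 f = ∑ᶜ (λ π → fromℝ (w π) *ᶜ f π) /ᶜ fromℝ (∑ w)

    Ψ : (G → ℂ) → ℂ
    Ψ M = 𝔼 (λ π → L π *ᶜ M π)

    Ψ₂ : (G → ℂ) → (G → ℂ) → ℂ
    Ψ₂ M N = 𝔼 (λ π → (L π *ᶜ M π) *ᶜ conj (L π *ᶜ N π))

    -- Ψ₂ M M as a real number.  Nothing is lost by dropping the imaginary part:
    -- the summands are w |L M|², so it vanishes.
    Ψ₂ᵣ : (G → ℂ) → ℝ
    Ψ₂ᵣ M = re (Ψ₂ M M)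

    SquareSummable : (G → ℂ) → Set
    SquareSummable M = Summable (λ π → w π * ∣ L π *ᶜ M π ∣²)

    βCases : ∀ M → Dec (Ψ₂ M M ≈ᶜ 0ᶜ) → ℝ
    βCases M (yes _) = 0#
    βCases M (no _)  = ∣ Ψ M ∣² / Ψ₂ᵣ M

    β : (G → ℂ) → ℝ
    β M = βCases M em

    infix 6 _⊕_⊙_
    _⊕_⊙_ : (G → ℂ) → ℂ → (G → ℂ) → G → ℂ
    (M ⊕ α ⊙ N) π = M π +ᶜ α *ᶜ N π

{-# OPTIONS --safe #-}
-- Write p = Ψ_M, q = Ψ_N, A = Ψ_{M,M}, B = Ψ_{N,N}, C = Ψ_{M,N}, D = A B − ∣C∣²
-- and Q(α) = Ψ_{M+αN,M+αN} = A + 2 Re(conj α C) + ∣α∣² B.  Nonnegativity of the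
-- variance gives ∣p + α q∣² ≤ Q(α).  At α = −C/B this reads ∣den∣² ≤ B D, and the
-- hypothesis β(N) ≤ (δ/4) β(M) keeps p B away from q C, so that den ≠ 0 and D > 0.
-- The Gram determinant of M + αN and Ψ_N M − Ψ_M N yields the identity
--   S Q(α) = D ∣p + α q∣² + ∣num − α den∣²,
-- where S is the numerator of the asserted maximum.  Hence β(M + αN) ≤ S / D, with
-- equality iff α = num / den, and α = 0 gives S / D = β(M) + ∣num∣² / (A D).  Parts
-- (i) and (ii) then estimate num = conj p C − conj q A by the parallelogram law.
module Submission where

open import Defs
open import Level using (0ℓ)
open import Algebra.Bundles using (CommutativeRing)
open import Algebra.Solver.Ring.AlmostCommutativeRing
  using (fromCommutativeRing; _-Raw-AlmostCommutative⟶_)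
open import Axiom.ExcludedMiddle using (ExcludedMiddle)
open import Data.Empty using (⊥-elim)
open import Data.Integer.Base as ℤ using (ℤ; -[1+_])
import Data.Integer.Properties as ℤ
open import Data.List.Base using (List; []; _∷_; _++_; [_]; deduplicate)
open import Data.List.Membership.Propositional.Properties
  using (∈-++⁺ˡ; ∈-++⁺ʳ; ∈-++⁻; ∈-∃++; ∈-deduplicate⁺)
open import Data.List.Relation.Binary.Subset.Propositional using (_⊆_)
open import Data.List.Relation.Unary.All using ([]; lookup)
open import Data.List.Relation.Unary.AllPairs using ([]; _∷_)
open import Data.List.Relation.Unary.Any using (here; there)
open import Data.List.Relation.Unary.Unique.Propositional using (Unique)
import Data.List.Relation.Unary.Unique.DecPropositional.Properties as DecUnique
open import Data.Maybe.Base using (map)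
open import Data.Nat.Base as ℕ using (ℕ; zero; suc)
import Data.Nat.Properties as ℕ
open import Data.Product using (∃; _×_; _,_; proj₁; proj₂)
open import Data.Sum.Base using (inj₁; inj₂)
open import Relation.Binary.Bundles using (Poset)
open import Relation.Binary.Consequences using (dec⇒weaklyDec)
import Relation.Binary.Construct.NonStrictToStrict as NonStrictToStrict
open import Relation.Binary.PropositionalEquality as ≡ using (_≡_)
import Relation.Binary.Reasoning.PartialOrder
open import Relation.Binary.Structures using (IsTotalOrder)
open import Relation.Nullary using (¬_; Dec; yes; no)
open import Relation.Nullary.Decidable using (decidable-stable)

-- Integer coefficients in a commutative ring, for the ring solver.

module IntegerCoefficients {c ℓ} (R : CommutativeRing c ℓ) where
  open CommutativeRing R
  open import Algebra.Properties.Ring ring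
  open import Algebra.Properties.Semiring.Mult.TCOptimised semiring
    using (1+×; ×-homo-+; ×1-homo-*) renaming (_×_ to _·_)
  open import Relation.Binary.Reasoning.Setoid setoid

  -- The canonical homomorphism from the integers. With the optimised multiples `1 · 1#` reduces to
  -- `1#`, so `1-homo` below is `refl`.
  ⟦_⟧ℤ : ℤ → Carrier
  ⟦ ℤ.+ n ⟧ℤ    = n · 1#
  ⟦ -[1+ n ] ⟧ℤ = - (suc n · 1#)

  ⊖-homo : ∀ m n → ⟦ m ℤ.⊖ n ⟧ℤ ≈ m · 1# - n · 1#
  ⊖-homo zero    zero    = sym (-‿inverseʳ 0#)
  ⊖-homo zero    (suc n) = sym (+-identityˡ _)
  ⊖-homo (suc m) zero    = sym (trans (+-congˡ -0#≈0#) (+-identityʳ _))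
  ⊖-homo (suc m) (suc n) = begin
    ⟦ suc m ℤ.⊖ suc n ⟧ℤ                    ≡⟨ ≡.cong ⟦_⟧ℤ (ℤ.[1+m]⊖[1+n]≡m⊖n m n) ⟩
    ⟦ m ℤ.⊖ n ⟧ℤ                            ≈⟨ ⊖-homo m n ⟩
    m · 1# - n · 1#                         ≈⟨ +-congʳ (xyx⁻¹≈y 1# (m · 1#)) ⟨
    1# + m · 1# - 1# - n · 1#               ≈⟨ +-assoc _ _ _ ⟩
    1# + m · 1# + (- 1# - n · 1#)           ≈⟨ +-congˡ (-‿+-comm 1# (n · 1#)) ⟩
    1# + m · 1# - (1# + n · 1#)             ≈⟨ +-cong (1+× m 1#) (-‿cong (1+× n 1#)) ⟨
    suc m · 1# - suc n · 1#                 ∎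

  ⟦⟧-neg : ∀ i → ⟦ ℤ.- i ⟧ℤ ≈ - ⟦ i ⟧ℤ
  ⟦⟧-neg (ℤ.+ zero)  = sym -0#≈0#
  ⟦⟧-neg (ℤ.+ suc n) = refl
  ⟦⟧-neg -[1+ n ]    = sym (-‿involutive _)

  ⟦⟧-+ : ∀ i j → ⟦ i ℤ.+ j ⟧ℤ ≈ ⟦ i ⟧ℤ + ⟦ j ⟧ℤ
  ⟦⟧-+ (ℤ.+ m)  (ℤ.+ n)  = ×-homo-+ 1# m n
  ⟦⟧-+ (ℤ.+ m)  -[1+ n ] = ⊖-homo m (suc n)
  ⟦⟧-+ -[1+ m ] (ℤ.+ n)  = trans (⊖-homo n (suc m)) (+-comm _ _)
  ⟦⟧-+ -[1+ m ] -[1+ n ] = begin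
    - (suc (suc (m ℕ.+ n)) · 1#)        ≡⟨ ≡.cong (λ k → - (k · 1#)) (≡.cong suc (ℕ.+-suc m n)) ⟨
    - ((suc m ℕ.+ suc n) · 1#)          ≈⟨ -‿cong (×-homo-+ 1# (suc m) (suc n)) ⟩
    - (suc m · 1# + suc n · 1#)         ≈⟨ -‿+-comm _ _ ⟨
    - (suc m · 1#) - suc n · 1#         ∎

  ⟦⟧-*⁺ : ∀ m j → ⟦ ℤ.+ m ℤ.* j ⟧ℤ ≈ m · 1# * ⟦ j ⟧ℤ
  ⟦⟧-*⁺ m (ℤ.+ n)  = trans (reflexive (≡.cong ⟦_⟧ℤ (≡.sym (ℤ.pos-* m n)))) (×1-homo-* m n)
  ⟦⟧-*⁺ m -[1+ n ] = begin
    ⟦ ℤ.+ m ℤ.* -[1+ n ] ⟧ℤ       ≡⟨ ≡.cong ⟦_⟧ℤ (ℤ.neg-distribʳ-* (ℤ.+ m) (ℤ.+ suc n)) ⟨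
    ⟦ ℤ.- (ℤ.+ m ℤ.* ℤ.+ suc n) ⟧ℤ  ≈⟨ ⟦⟧-neg (ℤ.+ m ℤ.* ℤ.+ suc n) ⟩
    - ⟦ ℤ.+ m ℤ.* ℤ.+ suc n ⟧ℤ    ≈⟨ -‿cong (⟦⟧-*⁺ m (ℤ.+ suc n)) ⟩
    - (m · 1# * suc n · 1#)       ≈⟨ -‿distribʳ-* _ _ ⟩
    m · 1# * - (suc n · 1#)       ∎

  ⟦⟧-* : ∀ i j → ⟦ i ℤ.* j ⟧ℤ ≈ ⟦ i ⟧ℤ * ⟦ j ⟧ℤ
  ⟦⟧-* (ℤ.+ m)  j = ⟦⟧-*⁺ m j
  ⟦⟧-* -[1+ m ] j = begin
    ⟦ -[1+ m ] ℤ.* j ⟧ℤ           ≡⟨ ≡.cong ⟦_⟧ℤ (ℤ.neg-distribˡ-* (ℤ.+ suc m) j) ⟨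
    ⟦ ℤ.- (ℤ.+ suc m ℤ.* j) ⟧ℤ    ≈⟨ ⟦⟧-neg (ℤ.+ suc m ℤ.* j) ⟩
    - ⟦ ℤ.+ suc m ℤ.* j ⟧ℤ        ≈⟨ -‿cong (⟦⟧-*⁺ (suc m) j) ⟩
    - (suc m · 1# * ⟦ j ⟧ℤ)       ≈⟨ -‿distribˡ-* _ _ ⟩
    - (suc m · 1#) * ⟦ j ⟧ℤ       ∎

  morphism : ℤ.+-*-rawRing -Raw-AlmostCommutative⟶ fromCommutativeRing R
  morphism = record
    { ⟦_⟧    = ⟦_⟧ℤ
    ; +-homo = ⟦⟧-+
    ; *-homo = ⟦⟧-*
    ; -‿homo = ⟦⟧-neg
    ; 0-homo = refl
    ; 1-homo = refl
    }

  open import Algebra.Solver.Ring ℤ.+-*-rawRing (fromCommutativeRing R) morphism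
    (λ i j → map (λ eq → reflexive (≡.cong ⟦_⟧ℤ eq)) (dec⇒weaklyDec ℤ._≟_ i j)) public
    using (Polynomial; solve; _:=_; con; _:+_; _:*_; _:-_; :-_)

  -- `:4` is `:2 :+ :2`, not the numeral 4, so that its denotation unfolds to the same sum as `4#`.
  :0 :1 :2 :4 : ∀ {n} → Polynomial n
  :0 = con (ℤ.+ 0)
  :1 = con (ℤ.+ 1)
  :2 = con (ℤ.+ 2)
  :4 = :2 :+ :2

-- Order arithmetic in the real field.

module OrderedField (𝓡 : CompleteOrderedField) where
  open CompleteOrderedField 𝓡
  open IntegerCoefficients commutativeRing public
  open IsTotalOrder isTotalOrder public
    using (isPartialOrder; total; antisym; ≤-respˡ-≈; ≤-respʳ-≈)
    renaming (refl to ≤-refl; reflexive to ≤-reflexive; trans to ≤-trans)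

  poset : Poset _ _ _
  poset = record { isPartialOrder = isPartialOrder }

  module ≤-Reasoning = Relation.Binary.Reasoning.PartialOrder poset
  open ≤-Reasoning
  open NonStrictToStrict _≈_ _≤_ public using (<⇒≤)

  <-≤-trans : ∀ {x y z} → x < y → y ≤ z → x < z
  <-≤-trans = NonStrictToStrict.<-≤-trans _≈_ _≤_ sym ≤-trans antisym ≤-respʳ-≈

  ≤-<-trans : ∀ {x y z} → x ≤ y → y < z → x < z
  ≤-<-trans = NonStrictToStrict.≤-<-trans _≈_ _≤_ ≤-trans antisym ≤-respˡ-≈

  <-cong : ∀ {x y u v} → x ≈ y → u ≈ v → x < u → y < v
  <-cong x≈y u≈v x<u = ≤-<-trans (≤-reflexive (sym x≈y)) (<-≤-trans x<u (≤-reflexive u≈v))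

  <⇒≱ : ∀ {x y} → x < y → ¬ (y ≤ x)
  <⇒≱ = NonStrictToStrict.<⇒≱ _≈_ _≤_ antisym

  ≰⇒> : ∀ {x y} → ¬ (x ≤ y) → y < x
  ≰⇒> = NonStrictToStrict.≰⇒> _≈_ _≤_ sym ≤-reflexive total

  0<⇒≉0 : ∀ {x} → 0# < x → ¬ (x ≈ 0#)
  0<⇒≉0 (_ , 0≉x) x≈0 = 0≉x (sym x≈0)

  -- Certificate form of an inequality: exhibit the nonnegative difference `d` and leave the
  -- equation to the ring solver. The main estimates all take this form.
  ≤-by : ∀ {x y d} → 0# ≤ d → x + d ≈ y → x ≤ y
  ≤-by {x} {y} {d} 0≤d eq = begin
    x       ≈⟨ +-identityʳ x ⟨
    x + 0#  ≤⟨ +-monoʳ-≤ x 0≤d ⟩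
    x + d   ≈⟨ eq ⟩
    y       ∎

  <-by : ∀ {x y d} → 0# < d → x + d ≈ y → x < y
  <-by {x} {y} {d} (0≤d , 0≉d) eq = ≤-by 0≤d eq , λ x≈y → 0≉d (begin-equality
    0#              ≈⟨ -‿inverseʳ x ⟨
    x - x           ≈⟨ +-congʳ (trans x≈y (sym eq)) ⟩
    x + d - x       ≈⟨ solve 2 (λ x d → x :+ d :- x := d) refl x d ⟩
    d               ∎)

  x≤y⇒0≤y-x : ∀ {x y} → x ≤ y → 0# ≤ y - x
  x≤y⇒0≤y-x {x} {y} x≤y = begin
    0#       ≈⟨ -‿inverseˡ x ⟨
    - x + x  ≤⟨ +-monoʳ-≤ (- x) x≤y ⟩
    - x + y  ≈⟨ +-comm (- x) y ⟩
    y - x    ∎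

  x<y⇒0<y-x : ∀ {x y} → x < y → 0# < y - x
  x<y⇒0<y-x {x} {y} (x≤y , x≉y) = x≤y⇒0≤y-x x≤y , λ 0≈y-x → x≉y (begin-equality
    x             ≈⟨ +-identityʳ x ⟨
    x + 0#        ≈⟨ +-congˡ 0≈y-x ⟩
    x + (y - x)   ≈⟨ solve 2 (λ x y → x :+ (y :- x) := y) refl x y ⟩
    y             ∎)

  +-mono-≤ : ∀ {x y u v} → x ≤ y → u ≤ v → x + u ≤ y + v
  +-mono-≤ {x} {y} {u} {v} x≤y u≤v = begin
    x + u  ≤⟨ +-monoʳ-≤ x u≤v ⟩
    x + v  ≈⟨ +-comm x v ⟩
    v + x  ≤⟨ +-monoʳ-≤ v x≤y ⟩
    v + y  ≈⟨ +-comm v y ⟩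
    y + v  ∎

  +-nonneg : ∀ {x y} → 0# ≤ x → 0# ≤ y → 0# ≤ x + y
  +-nonneg {x} {y} 0≤x 0≤y = ≤-respˡ-≈ (+-identityʳ 0#) (+-mono-≤ 0≤x 0≤y)

  +-pos : ∀ {x y} → 0# < x → 0# ≤ y → 0# < x + y
  +-pos {x} 0<x 0≤y = <-≤-trans 0<x (≤-by 0≤y refl)

  ²-nonneg : ∀ x → 0# ≤ x * x
  ²-nonneg x with total 0# x
  ... | inj₁ 0≤x = *-nonneg 0≤x 0≤x
  ... | inj₂ x≤0 = ≤-respʳ-≈ (solve 1 (λ x → (:0 :- x) :* (:0 :- x) := x :* x) refl x)
                             (*-nonneg (x≤y⇒0≤y-x x≤0) (x≤y⇒0≤y-x x≤0))

  0<1 : 0# < 1#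
  0<1 = ≤-respʳ-≈ (*-identityʳ 1#) (²-nonneg 1#) , λ 0≈1 → 1≉0 (sym 0≈1)

  0<2 : 0# < 2#
  0<2 = +-pos 0<1 (<⇒≤ 0<1)

  0<4 : 0# < 4#
  0<4 = +-pos 0<2 (<⇒≤ 0<2)

  x⁻¹*x≈1 : ∀ {x} → ¬ (x ≈ 0#) → x ⁻¹ * x ≈ 1#
  x⁻¹*x≈1 {x} x≉0 = trans (*-comm _ x) (*-inverseʳ x≉0)

  *-cancelˡ-0 : ∀ {x y} → ¬ (x ≈ 0#) → x * y ≈ 0# → y ≈ 0#
  *-cancelˡ-0 {x} {y} x≉0 xy≈0 = begin-equality
    y              ≈⟨ *-identityˡ y ⟨
    1# * y         ≈⟨ *-congʳ (x⁻¹*x≈1 x≉0) ⟨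
    x ⁻¹ * x * y   ≈⟨ *-assoc _ x y ⟩
    x ⁻¹ * (x * y) ≈⟨ *-congˡ xy≈0 ⟩
    x ⁻¹ * 0#      ≈⟨ zeroʳ _ ⟩
    0#             ∎

  *-pos : ∀ {x y} → 0# < x → 0# < y → 0# < x * y
  *-pos 0<x 0<y = *-nonneg (<⇒≤ 0<x) (<⇒≤ 0<y) ,
    λ 0≈xy → 0<⇒≉0 0<y (*-cancelˡ-0 (0<⇒≉0 0<x) (sym 0≈xy))

  *-monoˡ-≤ : ∀ {x y z} → 0# ≤ z → x ≤ y → z * x ≤ z * y
  *-monoˡ-≤ {x} {y} {z} 0≤z x≤y = ≤-by (*-nonneg 0≤z (x≤y⇒0≤y-x x≤y))
    (solve 3 (λ x y z → z :* x :+ z :* (y :- x) := z :* y) refl x y z)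

  *-cancelˡ-≤ : ∀ {x y z} → 0# < z → z * x ≤ z * y → x ≤ y
  *-cancelˡ-≤ {x} {y} 0<z zx≤zy with total x y
  ... | inj₁ x≤y = x≤y
  -- Multiplying `y≤x` by `z` gives the reverse of the hypothesis, so z (x - y) = 0 and the two are
  -- equal.
  ... | inj₂ y≤x = ≤-reflexive (begin-equality
    x              ≈⟨ solve 2 (λ x y → x := y :+ (x :- y)) refl x y ⟩
    y + (x - y)    ≈⟨ +-congˡ (*-cancelˡ-0 (0<⇒≉0 0<z) z[x-y]≈0) ⟩
    y + 0#         ≈⟨ +-identityʳ y ⟩
    y              ∎)
    where
    z[x-y]≈0 = trans (solve 3 (λ x y z → z :* (x :- y) := z :* x :- z :* y) refl x y _)
      (trans (+-congʳ (antisym zx≤zy (*-monoˡ-≤ (<⇒≤ 0<z) y≤x))) (-‿inverseʳ _))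

  *-cancelˡ-≈ : ∀ {x y z} → 0# < z → z * x ≈ z * y → x ≈ y
  *-cancelˡ-≈ 0<z eq = antisym (*-cancelˡ-≤ 0<z (≤-reflexive eq))
                               (*-cancelˡ-≤ 0<z (≤-reflexive (sym eq)))

  *-cancelˡ-pos : ∀ {x z} → 0# < z → 0# < z * x → 0# < x
  *-cancelˡ-pos {x} {z} 0<z 0<zx =
    *-cancelˡ-≤ 0<z (≤-respˡ-≈ (sym (zeroʳ z)) (<⇒≤ 0<zx)) ,
    λ 0≈x → 0<⇒≉0 0<zx (trans (*-congˡ (sym 0≈x)) (zeroʳ z))

  ⁻¹-pos : ∀ {x} → 0# < x → 0# < x ⁻¹
  ⁻¹-pos 0<x = *-cancelˡ-pos 0<x (<-≤-trans 0<1 (≤-reflexive (sym (*-inverseʳ (0<⇒≉0 0<x)))))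

  *-/-cancel : ∀ {x y} → ¬ (y ≈ 0#) → y * (x / y) ≈ x
  *-/-cancel {x} {y} y≉0 = begin-equality
    y * (x * y ⁻¹)  ≈⟨ solve 3 (λ x y z → y :* (x :* z) := x :* (y :* z)) refl x y (y ⁻¹) ⟩
    x * (y * y ⁻¹)  ≈⟨ *-congˡ (*-inverseʳ y≉0) ⟩
    x * 1#          ≈⟨ *-identityʳ x ⟩
    x               ∎

  ≈-/ : ∀ {x y z} → 0# < y → y * z ≈ x → z ≈ x / y
  ≈-/ 0<y yz≈x = *-cancelˡ-≈ 0<y (trans yz≈x (sym (*-/-cancel (0<⇒≉0 0<y))))

-- Complex arithmetic and its image in solver syntax.

module ComplexNumbers (em : ExcludedMiddle 0ℓ) (𝓡 : CompleteOrderedField) where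
  open Analysis em 𝓡
  open OrderedField 𝓡
  open ≤-Reasoning

  -- Pairs of polynomials mirror the coordinate formulas of ℂ exactly, so a complex identity becomes
  -- real polynomial identities that the solver accepts up to unfolding.
  :ℂ : ℕ → Set
  :ℂ n = Polynomial n × Polynomial n

  infixl 7 _:*ᶜ_
  infixl 6 _:+ᶜ_ _:-ᶜ_
  _:+ᶜ_ _:-ᶜ_ _:*ᶜ_ : ∀ {n} → :ℂ n → :ℂ n → :ℂ n
  (a , b) :+ᶜ (c , d) = (a :+ c) , (b :+ d)
  (a , b) :-ᶜ (c , d) = (a :- c) , (b :- d)
  (a , b) :*ᶜ (c , d) = (a :* c :- b :* d) , (a :* d :+ b :* c)

  :conj : ∀ {n} → :ℂ n → :ℂ n
  :conj (a , b) = a , (:- b)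

  :∣_∣² : ∀ {n} → :ℂ n → Polynomial n
  :∣ a , b ∣² = a :* a :+ b :* b

  :fromℝ : ∀ {n} → Polynomial n → :ℂ n
  :fromℝ a = a , :0

  ∣∣²-nonneg : ∀ z → 0# ≤ ∣ z ∣²
  ∣∣²-nonneg (a +i b) = +-nonneg (²-nonneg a) (²-nonneg b)

  ²≈0⇒≈0 : ∀ {x} → x * x ≈ 0# → x ≈ 0#
  ²≈0⇒≈0 xx≈0 = decidable-stable em λ x≉0 → x≉0 (*-cancelˡ-0 x≉0 xx≈0)

  -- If the sum of two squares vanishes, each square is at most 0 because the other is nonnegative.
  ∣∣²-pos : ∀ {z} → ¬ (z ≈ᶜ 0ᶜ) → 0# < ∣ z ∣²
  ∣∣²-pos {a +i b} z≉0 = ∣∣²-nonneg _ , λ 0≈∣z∣² → z≉0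
    ( ²≈0⇒≈0 (antisym (≤-by (²-nonneg b) (sym 0≈∣z∣²)) (²-nonneg a))
    , ²≈0⇒≈0 (antisym (≤-by (²-nonneg a) (trans (+-comm _ _) (sym 0≈∣z∣²))) (²-nonneg b)))

  ∣∣²-cong : ∀ {z z′} → z ≈ᶜ z′ → ∣ z ∣² ≈ ∣ z′ ∣²
  ∣∣²-cong (a≈ , b≈) = +-cong (*-cong a≈ a≈) (*-cong b≈ b≈)

  -- Since z′ conj z′ = ∣z′∣², each coordinate of the product is that of z times ∣z′∣² times its
  -- inverse.
  *ᶜ-/ᶜ-cancel : ∀ {z z′} → ¬ (∣ z′ ∣² ≈ 0#) → z′ *ᶜ (z /ᶜ z′) ≈ᶜ z
  *ᶜ-/ᶜ-cancel {a +i b} {c +i d} ∣z′∣²≉0 =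
    cancel _ (solve 5 (λ a b c d v → let z = a , b ; z′ = c , d in
      proj₁ (z′ :*ᶜ (z :*ᶜ (:conj z′ :*ᶜ :fromℝ v))) := a :* (:∣ z′ ∣² :* v)) refl a b c d v) ,
    cancel _ (solve 5 (λ a b c d v → let z = a , b ; z′ = c , d in
      proj₂ (z′ :*ᶜ (z :*ᶜ (:conj z′ :*ᶜ :fromℝ v))) := b :* (:∣ z′ ∣² :* v)) refl a b c d v)
    where
    v = ∣ c +i d ∣² ⁻¹
    cancel : ∀ x {y} → y ≈ x * (∣ c +i d ∣² * v) → y ≈ x
    cancel x y≈ = trans y≈ (trans (*-congˡ (*-inverseʳ ∣z′∣²≉0)) (*-identityʳ x))

  +ᶜ-cong : ∀ {z z′ u u′} → z ≈ᶜ z′ → u ≈ᶜ u′ → z +ᶜ u ≈ᶜ z′ +ᶜ u′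
  +ᶜ-cong (a , b) (c , d) = +-cong a c , +-cong b d

  -ᶜ-cong : ∀ {z z′ u u′} → z ≈ᶜ z′ → u ≈ᶜ u′ → z -ᶜ u ≈ᶜ z′ -ᶜ u′
  -ᶜ-cong (a , b) (c , d) = +-cong a (-‿cong c) , +-cong b (-‿cong d)

  *ᶜ-cong : ∀ {z z′ u u′} → z ≈ᶜ z′ → u ≈ᶜ u′ → z *ᶜ u ≈ᶜ z′ *ᶜ u′
  *ᶜ-cong (a , b) (c , d) =
    +-cong (*-cong a c) (-‿cong (*-cong b d)) , +-cong (*-cong a d) (*-cong b c)

  ≈ᶜ-refl : ∀ {z} → z ≈ᶜ z
  ≈ᶜ-refl = refl , refl

-- Polynomial identities and estimates for the family M + α N.

module QuadraticFamily (em : ExcludedMiddle 0ℓ) (𝓡 : CompleteOrderedField) where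
  open Analysis em 𝓡
  open OrderedField 𝓡
  open ComplexNumbers em 𝓡
  open ≤-Reasoning

  module Extremal (p q : ℂ) (A B : ℝ) (C : ℂ) where

    Q : ℂ → ℝ
    Q α = A + 2# * re (conj α *ᶜ C) + ∣ α ∣² * B

    D S : ℝ
    D = A * B - ∣ C ∣²
    S = ∣ q ∣² * A + ∣ p ∣² * B - 2# * re (conj p *ᶜ q *ᶜ C)

    num den : ℂ
    num = conj p *ᶜ C -ᶜ conj q *ᶜ fromℝ A
    den = conj q *ᶜ conj C -ᶜ conj p *ᶜ fromℝ B

    -- The Gram determinant of the vectors M + α N and Ψ_N M − Ψ_M N.
    gram : ∀ α → S * Q α ≈ D * ∣ p +ᶜ α *ᶜ q ∣² + ∣ num -ᶜ α *ᶜ den ∣²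
    gram α = solve 10 (λ p₁ p₂ q₁ q₂ A B c₁ c₂ a₁ a₂ →
      let p = p₁ , p₂ ; q = q₁ , q₂ ; C = c₁ , c₂ ; α = a₁ , a₂ in
      (:∣ q ∣² :* A :+ :∣ p ∣² :* B :- :2 :* proj₁ (:conj p :*ᶜ q :*ᶜ C)) :*
      (A :+ :2 :* proj₁ (:conj α :*ᶜ C) :+ :∣ α ∣² :* B) :=
      (A :* B :- :∣ C ∣²) :* :∣ p :+ᶜ α :*ᶜ q ∣² :+
      :∣ (:conj p :*ᶜ C :-ᶜ :conj q :*ᶜ :fromℝ A) :-ᶜ
         α :*ᶜ (:conj q :*ᶜ :conj C :-ᶜ :conj p :*ᶜ :fromℝ B) ∣²)
      refl (re p) (im p) (re q) (im q) A B (re C) (im C) (re α) (im α)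

    -- The case α = 0 of `gram`, where `Q` is A. It converts S / D into the second form of the
    -- maximum.
    A*S : A * S ≈ ∣ p ∣² * D + ∣ num ∣²
    A*S = solve 8 (λ p₁ p₂ q₁ q₂ A B c₁ c₂ → let p = p₁ , p₂ ; q = q₁ , q₂ ; C = c₁ , c₂ in
      A :* (:∣ q ∣² :* A :+ :∣ p ∣² :* B :- :2 :* proj₁ (:conj p :*ᶜ q :*ᶜ C)) :=
      :∣ p ∣² :* (A :* B :- :∣ C ∣²) :+ :∣ :conj p :*ᶜ C :-ᶜ :conj q :*ᶜ :fromℝ A ∣²)
      refl (re p) (im p) (re q) (im q) A B (re C) (im C)

    -- Completing the square in α: the minimum of `Q` is D / B, at α = -C/B.
    B*Q : ∀ α → ∣ C +ᶜ α *ᶜ fromℝ B ∣² + D ≈ B * Q α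
    B*Q α = solve 6 (λ A B c₁ c₂ a₁ a₂ → let C = c₁ , c₂ ; α = a₁ , a₂ in
      :∣ C :+ᶜ α :*ᶜ :fromℝ B ∣² :+ (A :* B :- :∣ C ∣²) :=
      B :* (A :+ :2 :* proj₁ (:conj α :*ᶜ C) :+ :∣ α ∣² :* B))
      refl A B (re C) (im C) (re α) (im α)

    -- Consequences of Jensen's inequality and of the smallness of β(N).

    module Estimates
      (0<P : 0# < ∣ p ∣²) (0<A : 0# < A) (0<B : 0# < B)
      (jensen : ∀ α → ∣ p +ᶜ α *ᶜ q ∣² ≤ Q α)
      {δ} (0<δ : 0# < δ) (2δ≤1 : 2# * δ ≤ 1#)
      (small : 4# * (∣ q ∣² * A) ≤ δ * (∣ p ∣² * B))
      where

      ∣den∣²≤B*D : ∣ den ∣² ≤ B * D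
      ∣den∣²≤B*D = begin
        ∣ den ∣²
          -- Up to sign and conjugation den is p B - q C. The added multiple 0 · q is a slot for
          -- `u`, which vanishes at α₀.
          ≈⟨ solve 7 (λ p₁ p₂ q₁ q₂ B c₁ c₂ → let p = p₁ , p₂ ; q = q₁ , q₂ ; C = c₁ , c₂ in
               :∣ :conj q :*ᶜ :conj C :-ᶜ :conj p :*ᶜ :fromℝ B ∣² :=
               :∣ (p :*ᶜ :fromℝ B :-ᶜ q :*ᶜ C) :+ᶜ :fromℝ :0 :*ᶜ q ∣²)
               refl (re p) (im p) (re q) (im q) B (re C) (im C) ⟩
        ∣ (p *ᶜ fromℝ B -ᶜ q *ᶜ C) +ᶜ 0ᶜ *ᶜ q ∣²
          ≈⟨ ∣∣²-cong (+ᶜ-cong ≈ᶜ-refl (*ᶜ-cong u≈0 ≈ᶜ-refl)) ⟨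
        ∣ (p *ᶜ fromℝ B -ᶜ q *ᶜ C) +ᶜ u *ᶜ q ∣²
          -- With u = C + α₀ B inserted, the terms q C cancel and B (p + α₀ q) remains.
          ≈⟨ solve 9 (λ p₁ p₂ q₁ q₂ B c₁ c₂ a₁ a₂ →
               let p = p₁ , p₂ ; q = q₁ , q₂ ; C = c₁ , c₂ ; α = a₁ , a₂ in
               :∣ (p :*ᶜ :fromℝ B :-ᶜ q :*ᶜ C) :+ᶜ (C :+ᶜ α :*ᶜ :fromℝ B) :*ᶜ q ∣² :=
               B :* (B :* :∣ p :+ᶜ α :*ᶜ q ∣²))
               refl (re p) (im p) (re q) (im q) B (re C) (im C) (re α₀) (im α₀) ⟩
        B * (B * ∣ p +ᶜ α₀ *ᶜ q ∣²)
          ≤⟨ *-monoˡ-≤ (<⇒≤ 0<B) (*-monoˡ-≤ (<⇒≤ 0<B) (jensen α₀)) ⟩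
        B * (B * Q α₀)
          ≈⟨ *-congˡ (B*Q α₀) ⟨
        B * (∣ u ∣² + D)
          ≈⟨ *-congˡ (+-congʳ (∣∣²-cong u≈0)) ⟩
        B * (∣ 0ᶜ ∣² + D)
          ≈⟨ solve 2 (λ B D → B :* (:∣ :fromℝ :0 ∣² :+ D) := B :* D) refl B D ⟩
        B * D ∎
        where
        α₀ u : ℂ
        -- The minimiser of `Q` found in `B*Q`; as B is real, the coordinates are divided
        -- separately.
        α₀ = (- re C / B) +i (- im C / B)
        u  = C +ᶜ α₀ *ᶜ fromℝ B

        cancel : ∀ x y → x + (- x / B * B - y * 0#) ≈ 0#
        cancel x y = begin-equality
          x + (- x / B * B - y * 0#)  ≈⟨ solve 4 (λ x y z B → x :+ (z :* B :- y :* :0) := x :+ B :* z) refl x y (- x / B) B ⟩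
          x + B * (- x / B)           ≈⟨ +-congˡ (*-/-cancel (0<⇒≉0 0<B)) ⟩
          x - x                       ≈⟨ -‿inverseʳ x ⟩
          0#                          ∎

        u≈0 : u ≈ᶜ 0ᶜ
        u≈0 = cancel (re C) (im α₀) , trans
          (solve 3 (λ y a b → y :+ (a :* :0 :+ b) := y :+ (b :- a :* :0)) refl (im C) (re α₀) (im α₀ * B))
          (cancel (im C) (re α₀))

      0≤D : 0# ≤ D
      0≤D = *-cancelˡ-≤ 0<B (begin
        B * 0#    ≈⟨ zeroʳ B ⟩
        0#        ≤⟨ ∣∣²-nonneg den ⟩
        ∣ den ∣²  ≤⟨ ∣den∣²≤B*D ⟩
        B * D     ∎)

      small′ = x≤y⇒0≤y-x small
      0≤1-2δ = x≤y⇒0≤y-x 2δ≤1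
      0≤P    = <⇒≤ 0<P
      0≤A    = <⇒≤ 0<A
      0≤B    = <⇒≤ 0<B
      0≤δ    = <⇒≤ 0<δ
      0≤2    = <⇒≤ 0<2
      0≤4    = <⇒≤ 0<4

      -- With x = p B and y = q C, the law 2 ∣x - y∣² = ∣x - 2 y∣² + ∣x∣² - 2 ∣y∣² is used four
      -- times over. Here `0≤D` and `small` give ∣q∣² ∣C∣² ≤ ∣q∣² A B ≤ (δ/4) ∣p∣² B, up to a factor
      -- B, so 8 ∣den∣² ≥ (4 - 2 δ) ∣p∣² B² ≥ 3 ∣p∣² B².
      0<∣den∣² : 0# < ∣ den ∣²
      0<∣den∣² = *-cancelˡ-pos (*-pos 0<2 0<4) (<-≤-trans
        (+-pos (*-pos (+-pos 0<2 (<⇒≤ 0<1)) (*-pos 0<P (*-pos 0<B 0<B)))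
          (+-nonneg (*-nonneg 0≤1-2δ (*-nonneg 0≤P (*-nonneg 0≤B 0≤B)))
          (+-nonneg (*-nonneg 0≤2 (*-nonneg 0≤B small′))
          (+-nonneg (*-nonneg (*-nonneg 0≤2 0≤4) (*-nonneg (∣∣²-nonneg q) 0≤D))
                    (*-nonneg 0≤4 (∣∣²-nonneg (p *ᶜ fromℝ B -ᶜ fromℝ 2# *ᶜ (q *ᶜ C))))))))
        (≤-reflexive (solve 9 (λ p₁ p₂ q₁ q₂ A B c₁ c₂ δ → let p = p₁ , p₂ ; q = q₁ , q₂ ; C = c₁ , c₂ in
          (:2 :+ :1) :* (:∣ p ∣² :* (B :* B)) :+
          ((:1 :- :2 :* δ) :* (:∣ p ∣² :* (B :* B)) :+
          (:2 :* (B :* (δ :* (:∣ p ∣² :* B) :- :4 :* (:∣ q ∣² :* A))) :+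
          (:2 :* :4 :* (:∣ q ∣² :* (A :* B :- :∣ C ∣²)) :+
          :4 :* :∣ p :*ᶜ :fromℝ B :-ᶜ :fromℝ :2 :*ᶜ (q :*ᶜ C) ∣²))) :=
          :2 :* :4 :* :∣ :conj q :*ᶜ :conj C :-ᶜ :conj p :*ᶜ :fromℝ B ∣²)
          refl (re p) (im p) (re q) (im q) A B (re C) (im C) δ)))

      0<D : 0# < D
      0<D = *-cancelˡ-pos 0<B (<-≤-trans 0<∣den∣² ∣den∣²≤B*D)

      -- Both terms on the left of `B*Q` are nonnegative and D is positive. Hence the default value
      -- 0 of `β` never occurs along the family.
      0<Q : ∀ α → 0# < Q α
      0<Q α = *-cancelˡ-pos 0<B (<-≤-trans (+-pos 0<D (∣∣²-nonneg (C +ᶜ α *ᶜ fromℝ B)))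
        (≤-reflexive (trans (+-comm _ _) (B*Q α))))

      -- Here `v` stands for β(M + α N), specified by a product to avoid division. The bound drops
      -- the last square in `gram`.
      D*value≤S : ∀ {α v} → Q α * v ≈ ∣ p +ᶜ α *ᶜ q ∣² → D * v ≤ S
      D*value≤S {α} {v} Qv≈ = *-cancelˡ-≤ (0<Q α) (begin
        Q α * (D * v)
          ≈⟨ solve 3 (λ Q D v → Q :* (D :* v) := D :* (Q :* v)) refl (Q α) D v ⟩
        D * (Q α * v)
          ≈⟨ *-congˡ Qv≈ ⟩
        D * ∣ p +ᶜ α *ᶜ q ∣²
          ≤⟨ ≤-by (∣∣²-nonneg (num -ᶜ α *ᶜ den)) (sym (gram α)) ⟩
        S * Q α
          ≈⟨ *-comm S (Q α) ⟩
        Q α * S ∎)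

      -- At the critical α the last square in `gram` is zero, so nothing is lost.
      D*value≈S : ∀ {α v} → num -ᶜ α *ᶜ den ≈ᶜ 0ᶜ → Q α * v ≈ ∣ p +ᶜ α *ᶜ q ∣² → D * v ≈ S
      D*value≈S {α} {v} critical Qv≈ = *-cancelˡ-≈ (0<Q α) (begin-equality
        Q α * (D * v)
          ≈⟨ solve 3 (λ Q D v → Q :* (D :* v) := D :* (Q :* v) :+ :∣ :fromℝ :0 ∣²) refl (Q α) D v ⟩
        D * (Q α * v) + ∣ 0ᶜ ∣²
          ≈⟨ +-cong (*-congˡ (sym Qv≈)) (∣∣²-cong critical) ⟨
        D * ∣ p +ᶜ α *ᶜ q ∣² + ∣ num -ᶜ α *ᶜ den ∣²
          ≈⟨ gram α ⟨
        S * Q α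
          ≈⟨ *-comm S (Q α) ⟩
        Q α * S ∎)

      -- For m = β(M) and v the maximum, `A*S` leaves only ∣num∣² after the term ∣p∣² D is
      -- subtracted.
      gain : ∀ {m v} → A * m ≈ ∣ p ∣² → D * v ≈ S → A * D * (v - m) ≈ ∣ num ∣²
      gain {m} {v} Am≈ Dv≈ = begin-equality
        A * D * (v - m)
          ≈⟨ solve 4 (λ A D v m → A :* D :* (v :- m) := A :* (D :* v) :- A :* m :* D) refl A D v m ⟩
        A * (D * v) - A * m * D
          ≈⟨ +-cong (*-congˡ Dv≈) (-‿cong (*-congʳ Am≈)) ⟩
        A * S - ∣ p ∣² * D
          ≈⟨ +-congʳ A*S ⟩
        ∣ p ∣² * D + ∣ num ∣² - ∣ p ∣² * D
          ≈⟨ solve 2 (λ x y → x :+ y :- x := y) refl (∣ p ∣² * D) ∣ num ∣² ⟩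
        ∣ num ∣² ∎

      -- 2 ∣x − y∣² + 2 ∣y∣² − ∣x∣² = ∣x − 2 y∣² for x = conj p C and y = conj q A
      gain-lower : δ * (A * B) ≤ ∣ C ∣² → δ * (∣ p ∣² * D) ≤ 4# * ∣ num ∣²
      gain-lower large = ≤-by
        (+-nonneg (*-nonneg 0≤δ (*-nonneg 0≤P (∣∣²-nonneg C)))
        (+-nonneg (*-nonneg 0≤2 (*-nonneg 0≤P (x≤y⇒0≤y-x large)))
        (+-nonneg (*-nonneg 0≤A small′)
                  (*-nonneg 0≤2 (∣∣²-nonneg (conj p *ᶜ C -ᶜ fromℝ 2# *ᶜ (conj q *ᶜ fromℝ A)))))))
        (solve 9 (λ p₁ p₂ q₁ q₂ A B c₁ c₂ δ → let p = p₁ , p₂ ; q = q₁ , q₂ ; C = c₁ , c₂ in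
          δ :* (:∣ p ∣² :* (A :* B :- :∣ C ∣²)) :+
          (δ :* (:∣ p ∣² :* :∣ C ∣²) :+
          (:2 :* (:∣ p ∣² :* (:∣ C ∣² :- δ :* (A :* B))) :+
          (A :* (δ :* (:∣ p ∣² :* B) :- :4 :* (:∣ q ∣² :* A)) :+
          :2 :* :∣ :conj p :*ᶜ C :-ᶜ :fromℝ :2 :*ᶜ (:conj q :*ᶜ :fromℝ A) ∣²))) :=
          :4 :* :∣ :conj p :*ᶜ C :-ᶜ :conj q :*ᶜ :fromℝ A ∣²)
          refl (re p) (im p) (re q) (im q) A B (re C) (im C) δ)

      -- For x = conj p C and y = conj q A, the parallelogram law gives 2 ∣x - y∣² ≤ 4 ∣x∣² + 4
      -- ∣y∣². The hypothesis bounds 4 ∣x∣² by 4 δ ∣p∣² A B and `small` bounds 4 ∣y∣² by δ ∣p∣² A B,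
      -- which is the source of the 5. Finally A B ≤ 2 D, because ∣C∣² ≤ δ A B and 2 δ ≤ 1.
      gain-upper : ∣ C ∣² ≤ δ * (A * B) → ∣ num ∣² ≤ 5# * (δ * (∣ p ∣² * D))
      gain-upper correlated = *-cancelˡ-≤ 0<2 (≤-by
        (+-nonneg (*-nonneg 0≤2 (∣∣²-nonneg (conj p *ᶜ C +ᶜ conj q *ᶜ fromℝ A)))
        (+-nonneg (*-nonneg 0≤4 (*-nonneg 0≤P 0≤slack))
        (+-nonneg (*-nonneg 0≤A small′)
                  (*-nonneg (+-nonneg 0≤4 (<⇒≤ 0<1)) (*-nonneg 0≤δ (*-nonneg 0≤P
                    (+-nonneg (*-nonneg (*-nonneg 0≤A 0≤B) 0≤1-2δ) (*-nonneg 0≤2 0≤slack))))))))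
        (solve 9 (λ p₁ p₂ q₁ q₂ A B c₁ c₂ δ → let p = p₁ , p₂ ; q = q₁ , q₂ ; C = c₁ , c₂ in
          :2 :* :∣ :conj p :*ᶜ C :-ᶜ :conj q :*ᶜ :fromℝ A ∣² :+
          (:2 :* :∣ :conj p :*ᶜ C :+ᶜ :conj q :*ᶜ :fromℝ A ∣² :+
          (:4 :* (:∣ p ∣² :* (δ :* (A :* B) :- :∣ C ∣²)) :+
          (A :* (δ :* (:∣ p ∣² :* B) :- :4 :* (:∣ q ∣² :* A)) :+
          (:4 :+ :1) :* (δ :* (:∣ p ∣² :*
            (A :* B :* (:1 :- :2 :* δ) :+ :2 :* (δ :* (A :* B) :- :∣ C ∣²))))))) :=
          :2 :* ((:4 :+ :1) :* (δ :* (:∣ p ∣² :* (A :* B :- :∣ C ∣²)))))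
          refl (re p) (im p) (re q) (im q) A B (re C) (im C) δ))
        where
        0≤slack = x≤y⇒0≤y-x correlated

-- Unordered sums: linearity, monotonicity, uniqueness, comparison.

module Summation (em : ExcludedMiddle 0ℓ) (𝓡 : CompleteOrderedField) where
  open Analysis em 𝓡
  open OrderedField 𝓡
  open ≤-Reasoning

  ≤-by-slack : ∀ {x y} → (∀ ε → 0# < ε → x ≤ y + (ε + ε)) → x ≤ y
  ≤-by-slack {x} {y} h = decidable-stable em λ x≰y →
    -- A quarter of the supposed gap makes the slack ε + ε only half of it.
    let ε   = (x - y) / 4#
        0<ε = *-pos (x<y⇒0<y-x (≰⇒> x≰y)) (⁻¹-pos 0<4)
    in x≰y (≤-by (*-nonneg (<⇒≤ 0<2) (x≤y⇒0≤y-x (h ε 0<ε))) (begin-equality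
      x + 2# * (y + (ε + ε) - x)    ≈⟨ solve 3 (λ x y ε → x :+ :2 :* (y :+ (ε :+ ε) :- x)
                                         := y :+ (y :- x) :+ :4 :* ε) refl x y ε ⟩
      y + (y - x) + 4# * ε          ≈⟨ +-congˡ (*-/-cancel (0<⇒≉0 0<4)) ⟩
      y + (y - x) + (x - y)         ≈⟨ solve 2 (λ x y → y :+ (y :- x) :+ (x :- y) := y) refl x y ⟩
      y                             ∎))

  Near : ℝ → ℝ → ℝ → Set
  Near s ε x = s - ε < x × x < s + ε

  -- Restates ∣x - s∣ < ε as two linear positivity conditions on the error x - s, a form in which
  -- errors add and scale.
  near⇒ : ∀ {s ε x} → Near s ε x → 0# < ε + (x - s) × 0# < ε - (x - s)
  near⇒ {s} {ε} {x} (l , u) =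
    <-≤-trans (x<y⇒0<y-x l) (≤-reflexive (solve 3 (λ s ε x → x :- (s :- ε) := ε :+ (x :- s)) refl s ε x)) ,
    <-≤-trans (x<y⇒0<y-x u) (≤-reflexive (solve 3 (λ s ε x → s :+ ε :- x := ε :- (x :- s)) refl s ε x))

  ⇒near : ∀ {s ε x} → 0# < ε + (x - s) → 0# < ε - (x - s) → Near s ε x
  ⇒near {s} {ε} {x} l u =
    <-by l (solve 3 (λ s ε x → s :- ε :+ (ε :+ (x :- s)) := x) refl s ε x) ,
    <-by u (solve 3 (λ s ε x → x :+ (ε :- (x :- s)) := s :+ ε) refl s ε x)

  near-cong : ∀ {s t ε δ x y} → s ≈ t → ε ≈ δ → x ≈ y → Near s ε x → Near t δ y
  near-cong s≈t ε≈δ x≈y (l , u) =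
    <-cong (+-cong s≈t (-‿cong ε≈δ)) x≈y l , <-cong x≈y (+-cong s≈t ε≈δ) u

  near-+ : ∀ {s t ε δ x y} → Near s ε x → Near t δ y → Near (s + t) (ε + δ) (x + y)
  near-+ {s} {t} {ε} {δ} {x} {y} p q = let l , u = near⇒ p ; l′ , u′ = near⇒ q in ⇒near
    (<-≤-trans (+-pos l (<⇒≤ l′)) (≤-reflexive (solve 6 (λ s t ε δ x y →
      ε :+ (x :- s) :+ (δ :+ (y :- t)) := ε :+ δ :+ (x :+ y :- (s :+ t))) refl s t ε δ x y)))
    (<-≤-trans (+-pos u (<⇒≤ u′)) (≤-reflexive (solve 6 (λ s t ε δ x y →
      ε :- (x :- s) :+ (δ :- (y :- t)) := ε :+ δ :- (x :+ y :- (s :+ t))) refl s t ε δ x y)))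

  1+c² : ℝ → ℝ
  1+c² c = 1# + c * c

  0<1+c² : ∀ c → 0# < 1+c² c
  0<1+c² c = +-pos 0<1 (²-nonneg c)

  -- ∣c∣ ≤ 1 + c² serves as Lipschitz constant of multiplication by c; it
  -- avoids the absolute value and is never 0.
  scale-slack : ∀ c {ε d} → 0# < ε + d → 0# < ε - d → 0# < 1+c² c * ε - c * d
  scale-slack c {ε} {d} l u = *-cancelˡ-pos 0<4 (<-≤-trans
    (+-pos (*-pos (+-pos (0<1+c² c) (²-nonneg (1# - c))) l)
           (<⇒≤ (*-pos (+-pos (0<1+c² c) (²-nonneg (1# + c))) u)))
    (≤-reflexive (solve 3 (λ c ε d →
      (:1 :+ c :* c :+ (:1 :- c) :* (:1 :- c)) :* (ε :+ d) :+
      (:1 :+ c :* c :+ (:1 :+ c) :* (:1 :+ c)) :* (ε :- d)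
        := :4 :* ((:1 :+ c :* c) :* ε :- c :* d)) refl c ε d)))

  near-*ˡ : ∀ c {s ε x} → Near s ε x → Near (c * s) (1+c² c * ε) (c * x)
  near-*ˡ c {s} {ε} {x} p = let l , u = near⇒ p in ⇒near
    -- The lower bound is `scale-slack` at the negated error, for which `l` and `u` exchange roles.
    (<-≤-trans (scale-slack c u
        (<-≤-trans l (≤-reflexive (solve 2 (λ ε d → ε :+ d := ε :- :- d) refl ε _))))
      (≤-reflexive (solve 4 (λ c s ε x → (:1 :+ c :* c) :* ε :- c :* :- (x :- s)
        := (:1 :+ c :* c) :* ε :+ (c :* x :- c :* s)) refl c s ε x)))
    (<-≤-trans (scale-slack c l u)
      (≤-reflexive (solve 4 (λ c s ε x → (:1 :+ c :* c) :* ε :- c :* (x :- s)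
        := (:1 :+ c :* c) :* ε :- (c :* x :- c :* s)) refl c s ε x)))

  module _ {G : Set} where

    finSum-cong : ∀ {f g : G → ℝ} → (∀ π → f π ≈ g π) → ∀ F → finSum f F ≈ finSum g F
    finSum-cong f≈g []      = refl
    finSum-cong f≈g (π ∷ F) = +-cong (f≈g π) (finSum-cong f≈g F)

    finSum-mono : ∀ {f g : G → ℝ} → (∀ π → f π ≤ g π) → ∀ F → finSum f F ≤ finSum g F
    finSum-mono f≤g []      = ≤-refl
    finSum-mono f≤g (π ∷ F) = +-mono-≤ (f≤g π) (finSum-mono f≤g F)

    finSum-+ : ∀ (f g : G → ℝ) F → finSum (λ π → f π + g π) F ≈ finSum f F + finSum g F
    finSum-+ f g []      = sym (+-identityʳ 0#)
    finSum-+ f g (π ∷ F) = trans (+-congˡ (finSum-+ f g F))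
      (solve 4 (λ a b s t → a :+ b :+ (s :+ t) := a :+ s :+ (b :+ t)) refl (f π) (g π) _ _)

    finSum-*ˡ : ∀ c (f : G → ℝ) F → finSum (λ π → c * f π) F ≈ c * finSum f F
    finSum-*ˡ c f []      = sym (zeroʳ c)
    finSum-*ˡ c f (π ∷ F) = trans (+-congˡ (finSum-*ˡ c f F)) (sym (distribˡ c _ _))

    finSum-++ : ∀ (f : G → ℝ) E F → finSum f (E ++ F) ≈ finSum f E + finSum f F
    finSum-++ f []      F = sym (+-identityˡ _)
    finSum-++ f (π ∷ E) F = trans (+-congˡ (finSum-++ f E F)) (sym (+-assoc (f π) _ _))

    finSum-nonneg : ∀ {f : G → ℝ} → (∀ π → 0# ≤ f π) → ∀ F → 0# ≤ finSum f F
    finSum-nonneg 0≤f []      = ≤-refl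
    finSum-nonneg 0≤f (π ∷ F) = +-nonneg (0≤f π) (finSum-nonneg 0≤f F)

    -- Induction on `E`: its head is cut out of `F`, and the tail still embeds in what remains
    -- because a duplicate-free list does not repeat its head.
    finSum-⊆ : ∀ {f : G → ℝ} → (∀ π → 0# ≤ f π) →
               ∀ {E F} → Unique E → E ⊆ F → finSum f E ≤ finSum f F
    finSum-⊆ 0≤f {[]} {F} _ _ = finSum-nonneg 0≤f F
    finSum-⊆ {f} 0≤f {π ∷ E} {F} (π∉E ∷ unique) E⊆F
      with F₁ , F₂ , ≡.refl ← ∈-∃++ (E⊆F (here ≡.refl)) = begin
        f π + finSum f E                       ≤⟨ +-monoʳ-≤ (f π) (finSum-⊆ 0≤f unique E⊆F₁++F₂) ⟩
        f π + finSum f (F₁ ++ F₂)              ≈⟨ +-congˡ (finSum-++ f F₁ F₂) ⟩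
        f π + (finSum f F₁ + finSum f F₂)      ≈⟨ solve 3 (λ a s t → a :+ (s :+ t) := s :+ (a :+ t)) refl (f π) _ _ ⟩
        finSum f F₁ + finSum f (π ∷ F₂)        ≈⟨ finSum-++ f F₁ (π ∷ F₂) ⟨
        finSum f (F₁ ++ π ∷ F₂)                ∎
      where
      E⊆F₁++F₂ : E ⊆ F₁ ++ F₂
      E⊆F₁++F₂ ρ∈E with ∈-++⁻ F₁ (E⊆F (there ρ∈E))
      ... | inj₁ ρ∈F₁           = ∈-++⁺ˡ ρ∈F₁
      ... | inj₂ (here ≡.refl)  = ⊥-elim (lookup π∉E ρ∈E ≡.refl)
      ... | inj₂ (there ρ∈F₂)   = ∈-++⁺ʳ F₁ ρ∈F₂

    -- `HasSum f s` unfolds to this condition, for each positive ε, on the partial sums being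
    -- `Near s ε`.
    Eventually : (List G → Set) → Set
    Eventually P = ∃ λ F₀ → Unique F₀ × (∀ F → Unique F → F₀ ⊆ F → P F)

    -- Directedness of the net. Removing duplicates requires decidable equality on `G`, which
    -- excluded middle supplies.
    union : (E F : List G) → ∃ λ H → Unique H × E ⊆ H × F ⊆ H
    union E F = deduplicate _≟_ (E ++ F) , DecUnique.deduplicate-! _≟_ (E ++ F) ,
      (λ π∈E → ∈-deduplicate⁺ _≟_ (∈-++⁺ˡ π∈E)) , (λ π∈F → ∈-deduplicate⁺ _≟_ (∈-++⁺ʳ E π∈F))
      where
      _≟_ : (π ρ : G) → Dec (π ≡ ρ)
      π ≟ ρ = em

    eventually-map₂ : ∀ {P Q R : List G → Set} → (∀ {F} → P F → Q F → R F) →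
                      Eventually P → Eventually Q → Eventually R
    eventually-map₂ h (E , _ , p) (F , _ , q) with H , unique , E⊆H , F⊆H ← union E F =
      H , unique , λ K unique-K H⊆K → h (p K unique-K (λ π∈E → H⊆K (E⊆H π∈E)))
                                        (q K unique-K (λ π∈F → H⊆K (F⊆H π∈F)))

    eventually-map : ∀ {P Q : List G → Set} → (∀ {F} → P F → Q F) → Eventually P → Eventually Q
    eventually-map h (F , unique , p) = F , unique , λ K unique-K F⊆K → h (p K unique-K F⊆K)

    eventually-inhabited : ∀ {P : List G → Set} → Eventually P → ∃ P
    eventually-inhabited (F , unique , p) = F , p F unique (λ π∈F → π∈F)

    hasSum-cong : ∀ {f g : G → ℝ} {s t} → (∀ π → f π ≈ g π) → s ≈ t → HasSum f s → HasSum g t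
    hasSum-cong f≈g s≈t h ε 0<ε =
      eventually-map (λ {F} → near-cong s≈t refl (finSum-cong f≈g F)) (h ε 0<ε)

    hasSum-+ : ∀ {f g : G → ℝ} {s t} → HasSum f s → HasSum g t → HasSum (λ π → f π + g π) (s + t)
    hasSum-+ {f} {g} h k ε 0<ε = eventually-map₂
      (λ {F} p q → near-cong refl
        (trans (solve 1 (λ x → x :+ x := :2 :* x) refl (ε / 2#)) (*-/-cancel (0<⇒≉0 0<2)))
        (sym (finSum-+ f g F)) (near-+ p q))
      (h (ε / 2#) 0<ε/2) (k (ε / 2#) 0<ε/2)
      where 0<ε/2 = *-pos 0<ε (⁻¹-pos 0<2)

    hasSum-*ˡ : ∀ c {f : G → ℝ} {s} → HasSum f s → HasSum (λ π → c * f π) (c * s)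
    hasSum-*ˡ c {f} h ε 0<ε = eventually-map
      (λ {F} p → near-cong refl (*-/-cancel (0<⇒≉0 (0<1+c² c))) (sym (finSum-*ˡ c f F)) (near-*ˡ c p))
      (h (ε / 1+c² c) (*-pos 0<ε (⁻¹-pos (0<1+c² c))))

    hasSum-mono : ∀ {f g : G → ℝ} {s t} → (∀ π → f π ≤ g π) → HasSum f s → HasSum g t → s ≤ t
    hasSum-mono {f} {g} {s} {t} f≤g h k = ≤-by-slack λ ε 0<ε →
      let F , (l , _) , (_ , u) = eventually-inhabited (eventually-map₂ _,_ (h ε 0<ε) (k ε 0<ε)) in begin
        s                   ≈⟨ solve 2 (λ s ε → s := ε :+ (s :- ε)) refl s ε ⟩
        ε + (s - ε)         ≤⟨ +-monoʳ-≤ ε (<⇒≤ l) ⟩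
        ε + finSum f F      ≤⟨ +-monoʳ-≤ ε (finSum-mono f≤g F) ⟩
        ε + finSum g F      ≤⟨ +-monoʳ-≤ ε (<⇒≤ u) ⟩
        ε + (t + ε)         ≈⟨ solve 2 (λ t ε → ε :+ (t :+ ε) := t :+ (ε :+ ε)) refl t ε ⟩
        t + (ε + ε)         ∎

    hasSum-unique : ∀ {f : G → ℝ} {s t} → HasSum f s → HasSum f t → s ≈ t
    hasSum-unique h k = antisym (hasSum-mono (λ _ → ≤-refl) h k) (hasSum-mono (λ _ → ≤-refl) k h)

    -- The witness chosen inside `∑` may differ from `s`, but sums are unique. The decision is
    -- generalised to `d` so that it can be matched on.
    ∑-value : ∀ {f : G → ℝ} {s} → HasSum f s → ∑ f ≈ s
    ∑-value {f} {s} h = cases em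
      where
      cases : (d : Dec (Summable f)) → valueOr0 d ≈ s
      cases (yes (t , k)) = hasSum-unique k h
      cases (no ¬summable) = ⊥-elim (¬summable (s , h))

    -- `F` is enlarged until its sum is within ε of `s`; with nonnegative terms this can only
    -- increase the sum.
    finSum≤sum : ∀ {f : G → ℝ} {s} → (∀ π → 0# ≤ f π) → HasSum f s →
                 ∀ {F} → Unique F → finSum f F ≤ s
    finSum≤sum {f} {s} 0≤f h {F} unique = ≤-by-slack λ ε 0<ε →
      let E , _ , near         = h ε 0<ε
          H , unique-H , F⊆H , E⊆H = union F E in begin
        finSum f F     ≤⟨ finSum-⊆ 0≤f unique F⊆H ⟩
        finSum f H     ≤⟨ <⇒≤ (proj₂ (near H unique-H E⊆H)) ⟩
        s + ε          ≤⟨ ≤-by (<⇒≤ 0<ε) (+-assoc s ε ε) ⟩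
        s + (ε + ε)    ∎

    -- Completeness enters here: the sum is the supremum of the finite partial sums, which the sum
    -- of `g` bounds.
    summable-≤ : ∀ {f g : G → ℝ} → (∀ π → 0# ≤ f π) → (∀ π → f π ≤ g π) → Summable g → Summable f
    summable-≤ {f} {g} 0≤f f≤g (t , h) =
      let s , upper , least = supremum IsPartialSum (0# , [] , [] , refl) (t , bounded) in
      s , λ ε 0<ε →
        let x , (F , unique , x≈) , s-ε<x = approximated s least ε 0<ε in
        -- One partial sum above s - ε suffices: larger index sets only increase it, and none
        -- exceeds `s`.
        F , unique , λ H unique-H F⊆H →
          <-≤-trans s-ε<x (≤-respˡ-≈ (sym x≈) (finSum-⊆ 0≤f unique F⊆H)) ,
          ≤-<-trans (upper _ (H , unique-H , refl)) (<-by 0<ε refl)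
      where
      IsPartialSum : ℝ → Set
      IsPartialSum x = ∃ λ F → Unique F × x ≈ finSum f F

      bounded : IsUpperBound IsPartialSum t
      bounded x (F , unique , x≈) = begin
        x              ≈⟨ x≈ ⟩
        finSum f F     ≤⟨ finSum-mono f≤g F ⟩
        finSum g F     ≤⟨ finSum≤sum (λ π → ≤-trans (0≤f π) (f≤g π)) h unique ⟩
        t              ∎

      -- Otherwise s - ε would be an upper bound smaller than the least one.
      approximated : ∀ s → (∀ b → IsUpperBound IsPartialSum b → s ≤ b) → ∀ ε → 0# < ε →
                     ∃ λ x → IsPartialSum x × s - ε < x
      approximated s least ε 0<ε = decidable-stable em λ none →
        <⇒≱ (<-by 0<ε (solve 2 (λ s ε → s :- ε :+ ε := s) refl s ε))
            (least (s - ε) λ x partial → decidable-stable em λ x≰ → none (x , partial , ≰⇒> x≰))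

-- Weighted means and the moments of L M.

module WeightedMeans (em : ExcludedMiddle 0ℓ) (𝓡 : CompleteOrderedField) where
  open Analysis em 𝓡
  open OrderedField 𝓡
  open ComplexNumbers em 𝓡
  open Summation em 𝓡
  open ≤-Reasoning

  module Moments
    {G : Set} (w : G → ℝ) (0≤w : ∀ π → 0# ≤ w π) (w≉0 : ¬ (∀ π → w π ≈ 0#)) (∑w : Summable w)
    where

    W : ℝ
    W = proj₁ ∑w

    -- Some weight is nonzero, hence positive, and it is itself a one-term partial sum bounded by
    -- `W`.
    0<W : 0# < W
    0<W = decidable-stable em λ W≯0 → w≉0 λ π → decidable-stable em λ wπ≉0 → W≯0 (begin-strict
      0#                  <⟨ 0≤w π , (λ 0≈wπ → wπ≉0 (sym 0≈wπ)) ⟩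
      w π                 ≈⟨ +-identityʳ (w π) ⟨
      finSum w [ π ]      ≤⟨ finSum≤sum 0≤w (proj₂ ∑w) ([] ∷ []) ⟩
      W                   ∎)

    -- The mean is stated without division, so its linearity is inherited directly from that of
    -- `HasSum`.
    Mean : (G → ℝ) → ℝ → Set
    Mean f m = HasSum (λ π → w π * f π) (W * m)

    HasMean : (G → ℝ) → Set
    HasMean f = ∃ (Mean f)

    mean-cong : ∀ {f g m n} → (∀ π → f π ≈ g π) → m ≈ n → Mean f m → Mean g n
    mean-cong f≈g m≈n = hasSum-cong (λ π → *-congˡ (f≈g π)) (*-congˡ m≈n)

    mean-+ : ∀ {f g m n} → Mean f m → Mean g n → Mean (λ π → f π + g π) (m + n)
    mean-+ h k = hasSum-cong (λ π → sym (distribˡ _ _ _)) (sym (distribˡ _ _ _)) (hasSum-+ h k)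

    mean-*ˡ : ∀ c {f m} → Mean f m → Mean (λ π → c * f π) (c * m)
    mean-*ˡ c h = hasSum-cong (λ π → swap c _ _) (swap c _ _) (hasSum-*ˡ c h)
      where
      swap : ∀ x y z → x * (y * z) ≈ y * (x * z)
      swap = solve 3 (λ x y z → x :* (y :* z) := y :* (x :* z)) refl

    mean-1 : Mean (λ _ → 1#) 1#
    mean-1 = hasSum-cong (λ π → sym (*-identityʳ _)) (sym (*-identityʳ _)) (proj₂ ∑w)

    mean-const : ∀ c → Mean (λ _ → c) c
    mean-const c = mean-cong (λ _ → *-identityʳ c) (*-identityʳ c) (mean-*ˡ c mean-1)

    mean-0 : Mean (λ _ → 0#) 0#
    mean-0 = mean-const 0#

    mean-nonneg : ∀ {f m} → (∀ π → 0# ≤ f π) → Mean f m → 0# ≤ m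
    mean-nonneg 0≤f h = *-cancelˡ-≤ 0<W
      (hasSum-mono (λ π → *-monoˡ-≤ (0≤w π) (0≤f π)) mean-0 h)

    summable⇒hasMean : ∀ {f} → Summable (λ π → w π * f π) → HasMean f
    summable⇒hasMean (s , h) = s / W , hasSum-cong (λ _ → refl) (sym (*-/-cancel (0<⇒≉0 0<W))) h

    hasMean-≤ : ∀ {f g} → (∀ π → 0# ≤ f π) → (∀ π → f π ≤ g π) → HasMean g → HasMean f
    hasMean-≤ 0≤f f≤g (m , h) = summable⇒hasMean
      (summable-≤ (λ π → *-nonneg (0≤w π) (0≤f π)) (λ π → *-monoˡ-≤ (0≤w π) (f≤g π)) (_ , h))

    -- Polarisation: f g is half of (f + g)² - f² - g², and (f + g)² has a mean by comparison with 2
    -- (f² + g²).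
    hasMean-* : ∀ (f g : G → ℝ) → HasMean (λ π → f π * f π) → HasMean (λ π → g π * g π) →
                HasMean (λ π → f π * g π)
    hasMean-* f g (a , h) (b , k) =
      let c , l = hasMean-≤ (λ π → ²-nonneg (f π + g π))
                    (λ π → ≤-by (²-nonneg (f π - g π)) (parallelogram (f π) (g π)))
                    (_ , mean-*ˡ 2# (mean-+ h k))
      in _ , mean-cong (λ π → polarised (f π) (g π)) refl
               (mean-*ˡ (2# ⁻¹) (mean-+ l (mean-*ˡ (- 1#) (mean-+ h k))))
      where
      parallelogram : ∀ x y → (x + y) * (x + y) + (x - y) * (x - y) ≈ 2# * (x * x + y * y)
      parallelogram = solve 2 (λ x y →
        (x :+ y) :* (x :+ y) :+ (x :- y) :* (x :- y) := :2 :* (x :* x :+ y :* y)) refl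

      polarised : ∀ x y → 2# ⁻¹ * ((x + y) * (x + y) + - 1# * (x * x + y * y)) ≈ x * y
      polarised x y = begin-equality
        2# ⁻¹ * ((x + y) * (x + y) + - 1# * (x * x + y * y))
          ≈⟨ solve 3 (λ h x y → h :* ((x :+ y) :* (x :+ y) :+ :- :1 :* (x :* x :+ y :* y))
               := (h :* :2) :* (x :* y)) refl (2# ⁻¹) x y ⟩
        2# ⁻¹ * 2# * (x * y)   ≈⟨ *-congʳ (x⁻¹*x≈1 (0<⇒≉0 0<2)) ⟩
        1# * (x * y)           ≈⟨ *-identityˡ _ ⟩
        x * y                  ∎

    -- The product of `f` with the constant 1, which is square summable because the weights are
    -- summable.
    hasMean-of-² : ∀ {f} → HasMean (λ π → f π * f π) → HasMean f
    hasMean-of-² {f} h =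
      let m , k = hasMean-* f (λ _ → 1#) h (_ , mean-cong (λ _ → sym (*-identityʳ 1#)) refl mean-1)
      in m , mean-cong (λ π → *-identityʳ (f π)) refl k

    -- First and second moments, and how they depend on α.

    module Twisted (L : G → ℂ) where
      open Weighted w L

      -- Both sides are multiplied by the total weight, whose squared modulus W² is positive, so the
      -- division in `𝔼` cancels. The solver supplies the terms from the zero imaginary part of
      -- `fromℝ`.
      𝔼-value : ∀ f {z} → Mean (λ π → re (f π)) (re z) → Mean (λ π → im (f π)) (im z) → 𝔼 f ≈ᶜ z
      𝔼-value f {z} h k =
        *-cancelˡ-≈ 0<W (begin-equality
          W * re (𝔼 f)
            ≈⟨ *-congʳ (sym T≈W) ⟩
          T * re (𝔼 f)
            ≈⟨ solve 3 (λ t a b → t :* a := t :* a :- :0 :* b) refl T (re (𝔼 f)) (im (𝔼 f)) ⟩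
          T * re (𝔼 f) - 0# * im (𝔼 f)
            ≈⟨ proj₁ cancel ⟩
          re (∑ᶜ (λ π → fromℝ (w π) *ᶜ f π))
            ≈⟨ ∑-value (hasSum-cong (λ π → solve 3 (λ t a b → t :* a := t :* a :- :0 :* b) refl
                 (w π) (re (f π)) (im (f π))) refl h) ⟩
          W * re z ∎) ,
        *-cancelˡ-≈ 0<W (begin-equality
          W * im (𝔼 f)
            ≈⟨ *-congʳ (sym T≈W) ⟩
          T * im (𝔼 f)
            ≈⟨ solve 3 (λ t a b → t :* b := t :* b :+ :0 :* a) refl T (re (𝔼 f)) (im (𝔼 f)) ⟩
          T * im (𝔼 f) + 0# * re (𝔼 f)
            ≈⟨ proj₂ cancel ⟩
          im (∑ᶜ (λ π → fromℝ (w π) *ᶜ f π))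
            ≈⟨ ∑-value (hasSum-cong (λ π → solve 3 (λ t a b → t :* b := t :* b :+ :0 :* a) refl
                 (w π) (re (f π)) (im (f π))) refl k) ⟩
          W * im z ∎)
        where
        T = ∑ w
        T≈W : T ≈ W
        T≈W = ∑-value (proj₂ ∑w)
        cancel = *ᶜ-/ᶜ-cancel {∑ᶜ (λ π → fromℝ (w π) *ᶜ f π)} {fromℝ T} λ ∣T∣²≈0 →
          0<⇒≉0 (*-pos 0<W 0<W) (begin-equality
            W * W              ≈⟨ *-cong T≈W T≈W ⟨
            T * T              ≈⟨ solve 1 (λ t → t :* t := t :* t :+ :0 :* :0) refl T ⟩
            T * T + 0# * 0#    ≈⟨ ∣T∣²≈0 ⟩
            0#                 ∎)

      LM : (G → ℂ) → G → ℂ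
      LM M π = L π *ᶜ M π

      ∣LM∣² : (G → ℂ) → G → ℝ
      ∣LM∣² M π = ∣ LM M π ∣²

      Ψ₂-value : ∀ M {a} → Mean (∣LM∣² M) a → Ψ₂ M M ≈ᶜ fromℝ a
      Ψ₂-value M h = 𝔼-value (λ π → LM M π *ᶜ conj (LM M π))
        (mean-cong (λ π → solve 2 (λ a b → :∣ a , b ∣² := proj₁ ((a , b) :*ᶜ :conj (a , b))) refl
          (re (LM M π)) (im (LM M π))) refl h)
        (mean-cong (λ π → solve 2 (λ a b → :0 := proj₂ ((a , b) :*ᶜ :conj (a , b))) refl
          (re (LM M π)) (im (LM M π))) refl mean-0)

      hasMean-re² : ∀ M → SquareSummable M → HasMean (λ π → re (LM M π) * re (LM M π))
      hasMean-re² M h = hasMean-≤ (λ π → ²-nonneg _) (λ π → ≤-by (²-nonneg (im (LM M π))) refl)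
        (summable⇒hasMean h)

      hasMean-im² : ∀ M → SquareSummable M → HasMean (λ π → im (LM M π) * im (LM M π))
      hasMean-im² M h = hasMean-≤ (λ π → ²-nonneg _) (λ π → ≤-by (²-nonneg (re (LM M π))) (+-comm _ _))
        (summable⇒hasMean h)

      -- Passes from the existence of some mean to the particular value that `𝔼` computes, so that
      -- later formulas can be written in Ψ.
      mean-via-𝔼 : ∀ f → HasMean (λ π → re (f π)) → HasMean (λ π → im (f π)) →
        Mean (λ π → re (f π)) (re (𝔼 f)) × Mean (λ π → im (f π)) (im (𝔼 f))
      mean-via-𝔼 f (a , h) (b , k) = let a≈ , b≈ = 𝔼-value f {a +i b} h k in
        mean-cong (λ _ → refl) (sym a≈) h , mean-cong (λ _ → refl) (sym b≈) k

      mean-Ψ : ∀ M → SquareSummable M →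
        Mean (λ π → re (LM M π)) (re (Ψ M)) × Mean (λ π → im (LM M π)) (im (Ψ M))
      mean-Ψ M h = mean-via-𝔼 (LM M) (hasMean-of-² (hasMean-re² M h)) (hasMean-of-² (hasMean-im² M h))

      mean-Ψ₂ᵣ : ∀ M → SquareSummable M → Mean (∣LM∣² M) (Ψ₂ᵣ M)
      mean-Ψ₂ᵣ M h = let a , k = summable⇒hasMean h in
        mean-cong (λ _ → refl) (sym (proj₁ (Ψ₂-value M k))) k

      Ψ₂-im : ∀ M → SquareSummable M → im (Ψ₂ M M) ≈ 0#
      Ψ₂-im M h = proj₂ (Ψ₂-value M (mean-Ψ₂ᵣ M h))

      Ψ₂ᵣ-nonneg : ∀ M → SquareSummable M → 0# ≤ Ψ₂ᵣ M
      Ψ₂ᵣ-nonneg M h = mean-nonneg (λ π → ∣∣²-nonneg (LM M π)) (mean-Ψ₂ᵣ M h)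

      -- The coordinates of X conj Y are combinations of four real products, each with a mean by
      -- `hasMean-*`.
      mean-Ψ₂ : ∀ M N → SquareSummable M → SquareSummable N →
        Mean (λ π → re (LM M π *ᶜ conj (LM N π))) (re (Ψ₂ M N)) ×
        Mean (λ π → im (LM M π *ᶜ conj (LM N π))) (im (Ψ₂ M N))
      mean-Ψ₂ M N h k = mean-via-𝔼 (λ π → X π *ᶜ conj (Y π))
        (_ , mean-cong (λ π → solve 4 (λ a b c d →
            a :* c :+ b :* d := proj₁ ((a , b) :*ᶜ :conj (c , d))) refl
            (re (X π)) (im (X π)) (re (Y π)) (im (Y π))) refl
          (mean-+ (proj₂ (hasMean-* (λ π → re (X π)) (λ π → re (Y π)) (hasMean-re² M h) (hasMean-re² N k)))
                  (proj₂ (hasMean-* (λ π → im (X π)) (λ π → im (Y π)) (hasMean-im² M h) (hasMean-im² N k)))))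
        (_ , mean-cong (λ π → solve 4 (λ a b c d →
            b :* c :+ :- :1 :* (a :* d) := proj₂ ((a , b) :*ᶜ :conj (c , d))) refl
            (re (X π)) (im (X π)) (re (Y π)) (im (Y π))) refl
          (mean-+ (proj₂ (hasMean-* (λ π → im (X π)) (λ π → re (Y π)) (hasMean-im² M h) (hasMean-re² N k)))
            (mean-*ˡ (- 1#)
                  (proj₂ (hasMean-* (λ π → re (X π)) (λ π → im (Y π)) (hasMean-re² M h) (hasMean-im² N k))))))
        where
        X = LM M
        Y = LM N

      -- The mean of ∣L M - Ψ M∣² expands to `Ψ₂ᵣ M` - ∣Ψ M∣², because the cross terms contribute -2
      -- ∣Ψ M∣² and the constant ∣Ψ M∣².
      ∣Ψ∣²≤Ψ₂ᵣ : ∀ M → SquareSummable M → ∣ Ψ M ∣² ≤ Ψ₂ᵣ M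
      ∣Ψ∣²≤Ψ₂ᵣ M h = ≤-by (mean-nonneg (λ π → ∣∣²-nonneg (LM M π -ᶜ Ψ M)) variance)
        (solve 3 (λ a x y → :∣ x , y ∣² :+
               (a :+ (((:- :2) :* x) :* x :+ ((:- :2) :* y) :* y :+ :∣ x , y ∣²)) := a)
           refl (Ψ₂ᵣ M) (re (Ψ M)) (im (Ψ M)))
        where
        variance = mean-cong
          (λ π → solve 4 (λ a b x y →
             :∣ a , b ∣² :+ (((:- :2) :* x) :* a :+ ((:- :2) :* y) :* b :+ :∣ x , y ∣²)
               := :∣ (a , b) :-ᶜ (x , y) ∣²) refl
             (re (LM M π)) (im (LM M π)) (re (Ψ M)) (im (Ψ M)))
          refl
          (mean-+ (mean-Ψ₂ᵣ M h) (mean-+ (mean-+ (mean-*ˡ (- 2# * re (Ψ M)) (proj₁ (mean-Ψ M h)))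
                                               (mean-*ˡ (- 2# * im (Ψ M)) (proj₂ (mean-Ψ M h))))
                                       (mean-const ∣ Ψ M ∣²)))

      module _ {M N} (h : SquareSummable M) (k : SquareSummable N) (α : ℂ) where

        -- Expansion of ∣l m + a l n∣², with cross term 2 Re(conj a · l m · conj (l n)). The same
        -- sum shows that M + α N is square summable and that its second moment is `Q`.
        mean-⊕ : Mean (∣LM∣² (M ⊕ α ⊙ N))
          (Ψ₂ᵣ M + 2# * re (conj α *ᶜ Ψ₂ M N) + ∣ α ∣² * Ψ₂ᵣ N)
        mean-⊕ = mean-cong
          (λ π → solve 8 (λ l₁ l₂ m₁ m₂ n₁ n₂ a₁ a₂ →
             let l = l₁ , l₂ ; m = m₁ , m₂ ; n = n₁ , n₂ ; a = a₁ , a₂ ; c = l :*ᶜ m :*ᶜ :conj (l :*ᶜ n) in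
             :∣ l :*ᶜ m ∣² :+ ((:2 :* a₁) :* proj₁ c :+ (:2 :* a₂) :* proj₂ c) :+ :∣ a ∣² :* :∣ l :*ᶜ n ∣²
               := :∣ l :*ᶜ (m :+ᶜ a :*ᶜ n) ∣²) refl
             (re (L π)) (im (L π)) (re (M π)) (im (M π)) (re (N π)) (im (N π)) (re α) (im α))
          (solve 6 (λ A B c₁ c₂ a₁ a₂ →
             A :+ ((:2 :* a₁) :* c₁ :+ (:2 :* a₂) :* c₂) :+ :∣ a₁ , a₂ ∣² :* B
               := A :+ :2 :* proj₁ (:conj (a₁ , a₂) :*ᶜ (c₁ , c₂)) :+ :∣ a₁ , a₂ ∣² :* B) refl
             (Ψ₂ᵣ M) (Ψ₂ᵣ N) (re (Ψ₂ M N)) (im (Ψ₂ M N)) (re α) (im α))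
          (mean-+ (mean-+ (mean-Ψ₂ᵣ M h) (mean-+ (mean-*ˡ (2# * re α) (proj₁ (mean-Ψ₂ M N h k)))
                                               (mean-*ˡ (2# * im α) (proj₂ (mean-Ψ₂ M N h k)))))
                  (mean-*ˡ ∣ α ∣² (mean-Ψ₂ᵣ N k)))

        squareSummable-⊕ : SquareSummable (M ⊕ α ⊙ N)
        squareSummable-⊕ = _ , mean-⊕

        Ψ₂-⊕ : Ψ₂ (M ⊕ α ⊙ N) (M ⊕ α ⊙ N) ≈ᶜ
          fromℝ (Ψ₂ᵣ M + 2# * re (conj α *ᶜ Ψ₂ M N) + ∣ α ∣² * Ψ₂ᵣ N)
        Ψ₂-⊕ = Ψ₂-value (M ⊕ α ⊙ N) mean-⊕

        Ψ-⊕ : Ψ (M ⊕ α ⊙ N) ≈ᶜ Ψ M +ᶜ α *ᶜ Ψ N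
        Ψ-⊕ = 𝔼-value (LM (M ⊕ α ⊙ N))
          (mean-cong (λ π → solve 8 (λ l₁ l₂ m₁ m₂ n₁ n₂ a₁ a₂ →
              let l = l₁ , l₂ ; m = m₁ , m₂ ; n = n₁ , n₂ ; a = a₁ , a₂ in
              proj₁ (l :*ᶜ m) :+ (a₁ :* proj₁ (l :*ᶜ n) :+ (:- a₂) :* proj₂ (l :*ᶜ n))
                := proj₁ (l :*ᶜ (m :+ᶜ a :*ᶜ n))) refl
              (re (L π)) (im (L π)) (re (M π)) (im (M π)) (re (N π)) (im (N π)) (re α) (im α))
            (solve 5 (λ p a b x y → p :+ (a :* x :+ (:- b) :* y) := p :+ (a :* x :- b :* y)) refl
              (re (Ψ M)) (re α) (im α) (re (Ψ N)) (im (Ψ N)))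
            (mean-+ (proj₁ (mean-Ψ M h)) (mean-+ (mean-*ˡ (re α) (proj₁ (mean-Ψ N k)))
                                               (mean-*ˡ (- im α) (proj₂ (mean-Ψ N k))))))
          (mean-cong (λ π → solve 8 (λ l₁ l₂ m₁ m₂ n₁ n₂ a₁ a₂ →
              let l = l₁ , l₂ ; m = m₁ , m₂ ; n = n₁ , n₂ ; a = a₁ , a₂ in
              proj₂ (l :*ᶜ m) :+ (a₁ :* proj₂ (l :*ᶜ n) :+ a₂ :* proj₁ (l :*ᶜ n))
                := proj₂ (l :*ᶜ (m :+ᶜ a :*ᶜ n))) refl
              (re (L π)) (im (L π)) (re (M π)) (im (M π)) (re (N π)) (im (N π)) (re α) (im α))
            refl
            (mean-+ (proj₂ (mean-Ψ M h)) (mean-+ (mean-*ˡ (re α) (proj₂ (mean-Ψ N k)))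
                                               (mean-*ˡ (im α) (proj₁ (mean-Ψ N k))))))

-- Transfer of the algebraic estimates to β.

module Maximisation (em : ExcludedMiddle 0ℓ) (𝓡 : CompleteOrderedField) where
  open Analysis em 𝓡
  open OrderedField 𝓡
  open ComplexNumbers em 𝓡
  open QuadraticFamily em 𝓡
  open WeightedMeans em 𝓡
  open ≤-Reasoning

  module Pair
    {G : Set} (L : G → ℂ) (w : G → ℝ)
    (0≤w : ∀ π → 0# ≤ w π) (w≉0 : ¬ (∀ π → w π ≈ 0#)) (∑w : Summable w)
    {δ : ℝ} (0<δ : 0# < δ) (δ<½ : δ < 1# / 2#)
    (M N : G → ℂ) (h : Weighted.SquareSummable w L M) (k : Weighted.SquareSummable w L N)
    (ΨMΨNN≉0 : ¬ (Weighted.Ψ w L M *ᶜ Weighted.Ψ₂ w L N N ≈ᶜ 0ᶜ))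
    (βN≤ : Weighted.β w L N ≤ (δ / 4#) * Weighted.β w L M)
    where
    open Weighted w L
    open Moments w 0≤w w≉0 ∑w using (module Twisted)
    open Twisted L

    p = Ψ M
    q = Ψ N
    A = Ψ₂ᵣ M
    B = Ψ₂ᵣ N
    C = Ψ₂ M N
    open Extremal p q A B C

    -- num and den use the real numbers A and B in place of the complex Ψ₂ M M and Ψ₂ N N.
    num′ = conj p *ᶜ C -ᶜ conj q *ᶜ Ψ₂ M M
    den′ = conj q *ᶜ conj C -ᶜ conj p *ᶜ Ψ₂ N N
    α₁   = num′ /ᶜ den′

    0<P : 0# < ∣ p ∣²
    0<P = ∣∣²-pos λ p≈0 → ΨMΨNN≉0
      ( trans (proj₁ (*ᶜ-cong p≈0 ≈ᶜ-refl))
          (solve 2 (λ a b → :0 :* a :- :0 :* b := :0) refl B (im (Ψ₂ N N)))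
      , trans (proj₂ (*ᶜ-cong p≈0 ≈ᶜ-refl))
          (solve 2 (λ a b → :0 :* b :+ :0 :* a := :0) refl B (im (Ψ₂ N N))))

    -- Jensen's inequality for M itself gives A ≥ ∣p∣² > 0.
    0<A : 0# < A
    0<A = <-≤-trans 0<P (∣Ψ∣²≤Ψ₂ᵣ M h)

    0<B : 0# < B
    0<B = Ψ₂ᵣ-nonneg N k , λ 0≈B → ΨMΨNN≉0
      ( trans (proj₁ (*ᶜ-cong (≈ᶜ-refl {p}) (sym 0≈B , Ψ₂-im N k)))
          (solve 2 (λ a b → a :* :0 :- b :* :0 := :0) refl (re p) (im p))
      , trans (proj₂ (*ᶜ-cong (≈ᶜ-refl {p}) (sym 0≈B , Ψ₂-im N k)))
          (solve 2 (λ a b → a :* :0 :+ b :* :0 := :0) refl (re p) (im p)))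

    Ψ₂ᵣ≈Q : ∀ α → Ψ₂ᵣ (M ⊕ α ⊙ N) ≈ Q α
    Ψ₂ᵣ≈Q α = proj₁ (Ψ₂-⊕ h k α)

    jensen : ∀ α → ∣ p +ᶜ α *ᶜ q ∣² ≤ Q α
    jensen α = begin
      ∣ p +ᶜ α *ᶜ q ∣²       ≈⟨ ∣∣²-cong (Ψ-⊕ h k α) ⟨
      ∣ Ψ (M ⊕ α ⊙ N) ∣²     ≤⟨ ∣Ψ∣²≤Ψ₂ᵣ (M ⊕ α ⊙ N) (squareSummable-⊕ h k α) ⟩
      Ψ₂ᵣ (M ⊕ α ⊙ N)        ≈⟨ Ψ₂ᵣ≈Q α ⟩
      Q α                    ∎

    -- A positive second moment rules out the branch where `β` takes its default value.
    β-value : ∀ Z → 0# < Ψ₂ᵣ Z → Ψ₂ᵣ Z * β Z ≈ ∣ Ψ Z ∣²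
    β-value Z 0<Ψ₂ᵣ = cases em
      where
      cases : ∀ d → Ψ₂ᵣ Z * βCases Z d ≈ ∣ Ψ Z ∣²
      cases (yes Ψ₂≈0) = ⊥-elim (0<⇒≉0 0<Ψ₂ᵣ (proj₁ Ψ₂≈0))
      cases (no _)     = *-/-cancel (0<⇒≉0 0<Ψ₂ᵣ)

    2δ≤1 : 2# * δ ≤ 1#
    2δ≤1 = begin
      2# * δ           ≤⟨ *-monoˡ-≤ (<⇒≤ 0<2) (<⇒≤ δ<½) ⟩
      2# * (1# / 2#)   ≈⟨ *-/-cancel (0<⇒≉0 0<2) ⟩
      1#               ∎

    4*δ/4 : 4# * (δ / 4#) ≈ δ
    4*δ/4 = *-/-cancel (0<⇒≉0 0<4)

    -- The hypothesis on β(N), multiplied by 4 A B to clear all quotients.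
    small : 4# * (∣ q ∣² * A) ≤ δ * (∣ p ∣² * B)
    small = begin
      4# * (∣ q ∣² * A)
        ≈⟨ *-congˡ (*-congʳ (β-value N 0<B)) ⟨
      4# * (B * β N * A)
        ≈⟨ solve 3 (λ A B n → :4 :* (B :* n :* A) := :4 :* A :* B :* n) refl A B (β N) ⟩
      4# * A * B * β N
        ≤⟨ *-monoˡ-≤ (<⇒≤ (*-pos (*-pos 0<4 0<A) 0<B)) βN≤ ⟩
      4# * A * B * (δ / 4# * β M)
        ≈⟨ solve 4 (λ A B f m → :4 :* A :* B :* (f :* m) := :4 :* f :* (A :* m :* B)) refl A B (δ / 4#) (β M) ⟩
      4# * (δ / 4#) * (A * β M * B)
        ≈⟨ *-cong 4*δ/4 (*-congʳ (β-value M 0<A)) ⟩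
      δ * (∣ p ∣² * B) ∎

    open Estimates 0<P 0<A 0<B jensen 0<δ 2δ≤1 small public

    value : ∀ α → Q α * β (M ⊕ α ⊙ N) ≈ ∣ p +ᶜ α *ᶜ q ∣²
    value α = begin-equality
      Q α * β (M ⊕ α ⊙ N)                  ≈⟨ *-congʳ (Ψ₂ᵣ≈Q α) ⟨
      Ψ₂ᵣ (M ⊕ α ⊙ N) * β (M ⊕ α ⊙ N)     ≈⟨ β-value (M ⊕ α ⊙ N) 0<Ψ₂ᵣ ⟩
      ∣ Ψ (M ⊕ α ⊙ N) ∣²                   ≈⟨ ∣∣²-cong (Ψ-⊕ h k α) ⟩
      ∣ p +ᶜ α *ᶜ q ∣²                     ∎
      where 0<Ψ₂ᵣ = <-≤-trans (0<Q α) (≤-reflexive (sym (Ψ₂ᵣ≈Q α)))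

    num′≈num : num′ ≈ᶜ num
    num′≈num = -ᶜ-cong ≈ᶜ-refl (*ᶜ-cong (≈ᶜ-refl {conj q}) (refl , Ψ₂-im M h))

    den′≈den : den′ ≈ᶜ den
    den′≈den = -ᶜ-cong ≈ᶜ-refl (*ᶜ-cong (≈ᶜ-refl {conj p}) (refl , Ψ₂-im N k))

    ∣den′∣²≉0 : ¬ (∣ den′ ∣² ≈ 0#)
    ∣den′∣²≉0 ∣den′∣²≈0 = 0<⇒≉0 0<∣den∣² (trans (sym (∣∣²-cong den′≈den)) ∣den′∣²≈0)

    den′≉0 : ¬ (den′ ≈ᶜ 0ᶜ)
    den′≉0 den′≈0 = ∣den′∣²≉0
      (trans (∣∣²-cong den′≈0) (solve 0 (:∣ :fromℝ :0 ∣² := :0) refl))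

    -- Replacing num by den′ α₁ and den by den′ reduces the claim to commutativity.
    critical : num -ᶜ α₁ *ᶜ den ≈ᶜ 0ᶜ
    critical =
      trans (proj₁ moved) (solve 4 (λ a b c d →
        proj₁ ((c , d) :*ᶜ (a , b) :-ᶜ (a , b) :*ᶜ (c , d)) := :0) refl (re α₁) (im α₁) (re den′) (im den′)) ,
      trans (proj₂ moved) (solve 4 (λ a b c d →
        proj₂ ((c , d) :*ᶜ (a , b) :-ᶜ (a , b) :*ᶜ (c , d)) := :0) refl (re α₁) (im α₁) (re den′) (im den′))
      where
      quotient : den′ *ᶜ α₁ ≈ᶜ num′
      quotient = *ᶜ-/ᶜ-cancel ∣den′∣²≉0

      moved : num -ᶜ α₁ *ᶜ den ≈ᶜ den′ *ᶜ α₁ -ᶜ α₁ *ᶜ den′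
      moved = -ᶜ-cong
        (sym (trans (proj₁ quotient) (proj₁ num′≈num)) , sym (trans (proj₂ quotient) (proj₂ num′≈num)))
        (*ᶜ-cong (≈ᶜ-refl {α₁}) (sym (proj₁ den′≈den) , sym (proj₂ den′≈den)))

    m  = β M
    v₁ = β (M ⊕ α₁ ⊙ N)

    Dv₁≈S : D * v₁ ≈ S
    Dv₁≈S = D*value≈S critical (value α₁)

    v₁≈S/D : v₁ ≈ S / D
    v₁≈S/D = ≈-/ 0<D Dv₁≈S

    maximal : ∀ α → β (M ⊕ α ⊙ N) ≤ v₁
    maximal α = *-cancelˡ-≤ 0<D (≤-trans (D*value≤S (value α)) (≤-reflexive (sym Dv₁≈S)))

    0<AD : 0# < A * D
    0<AD = *-pos 0<A 0<D

    Am≈P : A * m ≈ ∣ p ∣²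
    Am≈P = β-value M 0<A

    v₁-m : A * D * (v₁ - m) ≈ ∣ num ∣²
    v₁-m = gain Am≈P Dv₁≈S

    v₁≈ : v₁ ≈ m + ∣ num′ ∣² / (A * D)
    v₁≈ = begin-equality
      v₁                             ≈⟨ solve 2 (λ v m → v := m :+ (v :- m)) refl v₁ m ⟩
      m + (v₁ - m)                   ≈⟨ +-congˡ (≈-/ 0<AD (trans v₁-m (sym (∣∣²-cong num′≈num)))) ⟩
      m + ∣ num′ ∣² / (A * D)        ∎

    -- Multiplied by 4 A D, this is `gain-lower` with ∣num∣² rewritten through `v₁-m`.
    lower : δ * (A * B) ≤ ∣ C ∣² → δ / 4# * m ≤ v₁ - m
    lower large = *-cancelˡ-≤ (*-pos 0<4 0<AD) (begin
      4# * (A * D) * (δ / 4# * m)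
        ≈⟨ solve 4 (λ A D f m → :4 :* (A :* D) :* (f :* m) := :4 :* f :* (A :* m :* D)) refl A D (δ / 4#) m ⟩
      4# * (δ / 4#) * (A * m * D)
        ≈⟨ *-cong 4*δ/4 (*-congʳ Am≈P) ⟩
      δ * (∣ p ∣² * D)
        ≤⟨ gain-lower large ⟩
      4# * ∣ num ∣²
        ≈⟨ *-congˡ v₁-m ⟨
      4# * (A * D * (v₁ - m))
        ≈⟨ *-assoc _ _ _ ⟨
      4# * (A * D) * (v₁ - m) ∎)

    upper : ∣ C ∣² ≤ δ * (A * B) → ∀ α → β (M ⊕ α ⊙ N) - m ≤ 5# * δ * m
    upper correlated α = begin
      -- By maximality it suffices to bound the gain at α₁.
      β (M ⊕ α ⊙ N) - m    ≤⟨ +-mono-≤ (maximal α) ≤-refl ⟩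
      v₁ - m               ≤⟨ *-cancelˡ-≤ 0<AD AD*gain≤ ⟩
      5# * δ * m           ∎
      where
      AD*gain≤ : A * D * (v₁ - m) ≤ A * D * (5# * δ * m)
      AD*gain≤ = begin
        A * D * (v₁ - m)
          ≈⟨ v₁-m ⟩
        ∣ num ∣²
          ≤⟨ gain-upper correlated ⟩
        5# * (δ * (∣ p ∣² * D))
          ≈⟨ *-congˡ (*-congˡ (*-congʳ Am≈P)) ⟨
        5# * (δ * (A * m * D))
          ≈⟨ solve 5 (λ f A D δ m → f :* (δ :* (A :* m :* D)) := A :* D :* (f :* δ :* m)) refl 5# A D δ m ⟩
        A * D * (5# * δ * m) ∎

corollary2p10 :
  (em : ExcludedMiddle 0ℓ) (𝓡 : CompleteOrderedField) →
  let open Analysis em 𝓡 in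
  (G : Set) (L : G → ℂ) (w : G → ℝ) →
  (∀ π → 0# ≤ w π) → ¬ (∀ π → w π ≈ 0#) → Summable w →
  let open Weighted w L in
  (δ : ℝ) → 0# < δ → δ < 1# / 2# →
  (M N : G → ℂ) → SquareSummable M → SquareSummable N →
  ¬ (Ψ M *ᶜ Ψ₂ N N ≈ᶜ 0ᶜ) →
  β N ≤ (δ / 4#) * β M →
  let num = conj (Ψ M) *ᶜ Ψ₂ M N -ᶜ conj (Ψ N) *ᶜ Ψ₂ M M
      den = conj (Ψ N) *ᶜ conj (Ψ₂ M N) -ᶜ conj (Ψ M) *ᶜ Ψ₂ N N
      α₁  = num /ᶜ den
      D   = Ψ₂ᵣ M * Ψ₂ᵣ N - ∣ Ψ₂ M N ∣²
  in
  ¬ (den ≈ᶜ 0ᶜ)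
  × (∀ α → β (M ⊕ α ⊙ N) ≤ β (M ⊕ α₁ ⊙ N))
  × 0# < D
  × β (M ⊕ α₁ ⊙ N)
      ≈ (∣ Ψ N ∣² * Ψ₂ᵣ M + ∣ Ψ M ∣² * Ψ₂ᵣ N
          - 2# * re (conj (Ψ M) *ᶜ Ψ N *ᶜ Ψ₂ M N)) / D
  × 0# < Ψ₂ᵣ M * D
  × β (M ⊕ α₁ ⊙ N) ≈ β M + ∣ num ∣² / (Ψ₂ᵣ M * D)
  × (δ * (Ψ₂ᵣ M * Ψ₂ᵣ N) ≤ ∣ Ψ₂ M N ∣² →
      (δ / 4#) * β M ≤ β (M ⊕ α₁ ⊙ N) - β M)
  × (∣ Ψ₂ M N ∣² ≤ δ * (Ψ₂ᵣ M * Ψ₂ᵣ N) →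
      ∀ α → β (M ⊕ α ⊙ N) - β M ≤ (5# * δ) * β M)
corollary2p10 em 𝓡 G L w 0≤w w≉0 ∑w δ 0<δ δ<½ M N h k ΨMΨNN≉0 βN≤ =
  den′≉0 , maximal , 0<D , v₁≈S/D , 0<AD , v₁≈ , lower , upper
  where open Maximisation.Pair em 𝓡 L w 0≤w w≉0 ∑w 0<δ δ<½ M N h k ΨMΨNN≉0 βN≤
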